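{- Let $q>9$ be a power of an odd prime, let $\mathcal{Q}$ be the set of nonzero squares and $\mathcal{N}$ the set of nonsquares in $\mathrm{GF}(q)$. Let $\tau\in\mathrm{GF}(q)^*$, $B_\tau=\mathcal{Q}\,\triangle\,(\mathcal{Q}+\tau)$ (symmetric difference, with $\mathcal{Q}+\tau=\{x+\tau:x\in\mathcal{Q}\}$), $\mathcal{P}=\mathrm{GF}(q)$ and $\mathcal{B}=\{g(B_\tau):g\in\mathrm{GA}_1(q)\}$, where $\mathrm{GA}_1(q)=\{x\mapsto ax+b:a\in\mathrm{GF}(q)^*,b\in\mathrm{GF}(q)\}$. Then $(\mathcal{P},\mathcal{B})$ is a $2$-$(q,k,\lambda)$ design, where $$k=\begin{cases}\frac{q+1}{2} & \text{if } q\equiv 3\pmod 4,\\ \frac{q+3}{2} & \text{if } q\equiv 1\pmod 4\text{ and }\tau\in\mathcal{Q},\\ \frac{q-1}{2} & \text{if } q\equiv 1\pmod 4\text{ and }\tau\in\mathcal{N},\end{cases}\qquad \lambda=\begin{cases}k(k-1) & \text{if } q\equiv 3\pmod 4,\\ \frac{k(k-1)}{2} & \text{if } q\equiv 1\pmod 4.\end{cases}$$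
   Context: A $t$-$(v,k,\lambda)$ design is a pair $(\mathcal{P},\mathcal{B})$ with $|\mathcal{P}|=v$ and $\mathcal{B}$ a set of $k$-subsets of $\mathcal{P}$ (blocks) such that every $t$-subset of $\mathcal{P}$ lies in exactly $\lambda$ blocks. -}

module Defs where

open import Level using (0ℓ)
open import Data.Nat using (ℕ; _+_; _*_)
open import Data.Fin using (Fin)
open import Data.Fin.Subset using (Subset; _∈_; _⊆_; ∣_∣)
open import Data.Fin.Subset.Properties using (_⊆?_)
open import Data.List using (List; length; filter)
open import Data.List.Relation.Unary.Unique.Propositional using (Unique)
import Data.List.Membership.Propositional as LM
open import Data.Product using (Σ; ∃; _×_; _,_)
open import Data.Sum using (_⊎_)
open import Relation.Binary.PropositionalEquality using (_≡_; _≢_)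
open import Relation.Nullary using (¬_)
open import Algebra.Structures using (IsCommutativeRing)
open import Function.Bundles using (_⇔_)

-- A field whose underlying set is Fin q (every finite field of order q,
-- in particular GF(q), is isomorphic to one of this form), with
-- propositional equality.
record FieldOn (q : ℕ) : Set where
  field
    _+F_ _*F_ : Fin q → Fin q → Fin q
    -F_       : Fin q → Fin q
    0F 1F     : Fin q
    isCommRing : IsCommutativeRing {A = Fin q} _≡_ _+F_ _*F_ -F_ 0F 1F
    0≢1        : 0F ≢ 1F
    inverse    : ∀ x → x ≢ 0F → ∃ λ y → x *F y ≡ 1F

module _ {q : ℕ} (F : FieldOn q) where
  open FieldOn F

  IsSquare : Fin q → Set
  IsSquare x = x ≢ 0F × ∃ λ y → y *F y ≡ x

  IsNonsquare : Fin q → Set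
  IsNonsquare x = x ≢ 0F × ¬ (∃ λ y → y *F y ≡ x)

  InShift : Fin q → Fin q → Set
  InShift τ x = ∃ λ y → IsSquare y × x ≡ y +F τ

  InB : Fin q → Fin q → Set
  InB τ x = (IsSquare x × ¬ InShift τ x) ⊎ (InShift τ x × ¬ IsSquare x)

  IsBlock : Fin q → Subset q → Set
  IsBlock τ S = Σ (Fin q) λ a → Σ (Fin q) λ b → a ≢ 0F ×
    (∀ x → (x ∈ S) ⇔ (∃ λ y → InB τ y × x ≡ (a *F y) +F b))

IsDesign : (t v k λ' : ℕ) → (Subset v → Set) → Set
IsDesign t v k λ' isBlock =
  Σ (List (Subset v)) λ L →
    Unique L ×
    (∀ S → (S LM.∈ L) ⇔ isBlock S) ×
    (∀ S → isBlock S → ∣ S ∣ ≡ k) ×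
    (∀ (T : Subset v) → ∣ T ∣ ≡ t → length (filter (T ⊆?_) L) ≡ λ')

{-# OPTIONS --safe #-}
-- In the affine coordinate v with x = τ (v + 2) / 4, a point v ≠ ±2 lies
-- outside the base block B iff v² - 4 is a nonzero square.  Parametrising the
-- hyperbola z² = v² - 4 by v = s + 1/s therefore turns a sum of h over B into
-- the sum of h(s + 1/s) over s ≠ 0, up to boundary terms at v = ±2.  Counting
-- gives |B|; power sums in the field give the moments Σ v^j over B as explicit
-- integers for j < q - 1.  If |B| ≠ 0 in the field, an affine map stabilising B
-- fixes its barycentre, so its multiplier α satisfies α^j = 1 whenever the j-th
-- central moment does not vanish.  A few small j, with separate choices in
-- characteristics 3, 5 and 7, leave only the identity, and for q ≡ 1 (mod 4)
-- also x ↦ τ - x, which does stabilise B.  If |B| = 0 in the field, the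
-- characteristic is 3, and expanding the moments of order 5 = 3 + 2 and
-- 11 = 9 + 2 gives the same conclusion.  As the affine group is sharply
-- 2-transitive, λ is k (k - 1) divided by the order of the stabiliser.
module Submission where

open import Defs
open import Level using (0ℓ)
open import Algebra.Bundles using (CommutativeRing; CommutativeSemiring)
open import Algebra.Structures using (IsCommutativeRing; IsCommutativeSemiring)
open import Data.Bool.Base using (Bool; true; false; if_then_else_)
open import Data.Fin.Base as Fin using (Fin; zero; suc)
open import Data.Fin.Permutation using (permutation)
open import Data.Fin.Properties
  using (_≟_; _<?_; <-cmp; <-asym; <-irrefl; any?; suc-injective; ¬∀⟶∃¬)
open import Data.Fin.Subset using (Subset; _∈_; ∣_∣; inside; outside)
open import Data.Fin.Subset.Properties using (_⊆?_; ⊆-antisym)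
open import Data.Integer.Base as ℤ using (ℤ; -[1+_]) renaming (+_ to pos; -_ to neg)
import Data.Integer.Properties as ℤₚ
open import Data.List.Base as List using (List; []; _∷_; length; allFin; filter; cartesianProduct)
import Data.List.Membership.Propositional as LM
open import Data.List.Membership.Propositional.Properties
  using (∈-map⁺; ∈-map⁻; ∈-filter⁺; ∈-filter⁻; ∈-allFin; ∈-cartesianProduct⁺)
open import Data.List.Properties using (length-tabulate; map-++; map-∘; map-tabulate)
open import Data.List.Relation.Unary.All as All using (All; []; _∷_)
import Data.List.Relation.Unary.All.Properties as Allₚ
open import Data.List.Relation.Unary.AllPairs using ([]; _∷_)
open import Data.List.Relation.Unary.Any using (here; there)
open import Data.List.Relation.Unary.Unique.Propositional using (Unique)
import Data.List.Relation.Unary.Unique.Propositional.Properties as Uniqueₚ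
open import Data.Maybe.Base using (map)
open import Data.Nat.Base as ℕ using (ℕ; zero; suc)
open import Data.Nat.ListAction using () renaming (sum to sumᴸ)
open import Data.Nat.ListAction.Properties using (sum-++)
import Data.Nat.Properties as ℕₚ
open import Data.Product using (_×_; _,_; ∃; proj₁; proj₂; uncurry)
open import Data.Sum using (_⊎_; inj₁; inj₂; [_,_]′)
open import Data.Vec.Base as Vec using (Vec; []; _∷_; tabulate; here; there)
open import Data.Vec.Properties using ([]=⇒lookup; lookup⇒[]=; lookup∘tabulate)
open import Function.Base using (_∘_)
open import Function.Bundles using (mk⇔; Equivalence)
open import Relation.Binary.Definitions using (tri<; tri≈; tri>)
open import Relation.Binary.PropositionalEquality hiding ([_])
open import Relation.Nullary hiding (stable)
open import Relation.Nullary.Decidable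
  using (_×-dec_; _⊎-dec_; _→-dec_; ¬?; dec-true; dec-false; dec⇒maybe; from-yes)
open import Relation.Unary using (Decidable)

-- The counting identity is kept doubled and free of subtraction, so that it makes sense in every
-- commutative semiring: over ℕ it yields the block size, over the field the moments. The boundary
-- terms enter through the quadratic characters e₁, e₂ = ±1 of τ and -τ, which are opposite when q ≡
-- 3 (mod 4) and equal when q ≡ 1 (mod 4). As Σ (s + 1/s)^j over s ≠ 0 picks out minus the constant
-- term, the doubled j-th moment is C(j, j/2) + e₁ 2^j + e₂ (-2)^j, without the binomial for odd j.
-- In particular twice the block size is 1 + e₁ + e₂ in the field, that is 1, -1 or 3, so it
-- vanishes only in characteristic 3 with e₁ = e₂ = 1. A moment is a fixed integer that may vanish
-- modulo the characteristic; hence the exceptional primes, each met by exponents whose moments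
-- survive there. With equal signs all odd moments vanish, so only α² = 1 can come out. The range j
-- < q - 1 admits j ≤ 8 when q > 9 and j ≤ 11 when q ≥ 13.

-- Finite sums and indicators in a commutative semiring

module Sums {R : Set} {_+_ _*_ : R → R → R} {0# 1# : R}
            (isCSR : IsCommutativeSemiring _≡_ _+_ _*_ 0# 1#) where

  commutativeSemiring : CommutativeSemiring 0ℓ 0ℓ
  commutativeSemiring = record { isCommutativeSemiring = isCSR }

  open CommutativeSemiring commutativeSemiring
    using (semiring; +-identityˡ; +-identityʳ; *-identityˡ; zeroˡ)

  open import Algebra.Properties.Semiring.Sum semiring public
    using (sum; sum-cong-≗; sum-permute; ∑-distrib-+; ∑-comm; *-distribˡ-sum; *-distribʳ-sum)

  [_] : {P : Set} → Dec P → R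
  [ p ] = if does p then 1# else 0#

  []-true : {P : Set} (p : Dec P) → P → [ p ] ≡ 1#
  []-true p x = cong (if_then 1# else 0#) (dec-true p x)

  []-false : {P : Set} (p : Dec P) → ¬ P → [ p ] ≡ 0#
  []-false p x = cong (if_then 1# else 0#) (dec-false p x)

  []-cong : {P Q : Set} (p : Dec P) (q : Dec Q) → (P → Q) → (Q → P) → [ p ] ≡ [ q ]
  []-cong p (yes y) f g = []-true p (g y)
  []-cong p (no ¬y) f g = []-false p (¬y ∘ f)

  sum-zero : ∀ {n} {f : Fin n → R} → (∀ x → f x ≡ 0#) → sum f ≡ 0#
  sum-zero {zero} f≡0 = refl
  sum-zero {suc n} f≡0 = trans (cong₂ _+_ (f≡0 zero) (sum-zero (f≡0 ∘ suc))) (+-identityˡ 0#)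

  sum-[≟] : ∀ {n} (a : Fin n) (f : Fin n → R) → sum (λ x → [ x ≟ a ] * f x) ≡ f a
  sum-[≟] zero f = trans
    (cong₂ _+_ (*-identityˡ _) (sum-zero (λ x → zeroˡ (f (suc x))))) (+-identityʳ _)
  sum-[≟] (suc a) f = trans (cong₂ _+_ (zeroˡ _) (trans
    (sum-cong-≗ (λ x → cong (_* f (suc x)) ([]-cong (suc x ≟ suc a) (x ≟ a) suc-injective (cong suc))))
    (sum-[≟] a (f ∘ suc)))) (+-identityˡ _)

  sum-[unique] : ∀ {n} {P : Fin n → Set} (P? : ∀ x → Dec (P x)) (a : Fin n) →
                 P a → (∀ {x} → P x → x ≡ a) → (f : Fin n → R) →
                 sum (λ x → [ P? x ] * f x) ≡ f a
  sum-[unique] P? a Pa unique f = trans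
    (sum-cong-≗ (λ x → cong (_* f x) ([]-cong (P? x) (x ≟ a) unique (λ { refl → Pa }))))
    (sum-[≟] a f)

  sum-reindex : ∀ {n} (f g : Fin n → Fin n) → (∀ x → f (g x) ≡ x) → (∀ x → g (f x) ≡ x) →
                (h : Fin n → R) → sum (h ∘ f) ≡ sum h
  sum-reindex f g fg gf h = sym (sum-permute h (permutation f g fg gf))

module Count = Sums ℕₚ.+-*-isCommutativeSemiring

module _ where
  open Count

  sum-one : ∀ n → sum {n} (λ _ → 1) ≡ n
  sum-one zero = refl
  sum-one (suc n) = cong suc (sum-one n)

  -- The counting step behind the product rule for nonsquares: a pointwise bound between functions
  -- with equal totals leaves no slack anywhere.
  ≤∧sum≡⇒≡ : ∀ {n} (f g : Fin n → ℕ) → (∀ x → f x ℕ.≤ g x) → sum f ≡ sum g → ∀ x → f x ≡ g x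
  ≤∧sum≡⇒≡ {suc n} f g f≤g eq = λ where
      zero → head≡
      (suc x) → ≤∧sum≡⇒≡ (f ∘ suc) (g ∘ suc) (f≤g ∘ suc)
                  (ℕₚ.+-cancelˡ-≡ (f zero) _ _ (trans eq (cong (ℕ._+ sum (g ∘ suc)) (sym head≡)))) x
    where
    sum-mono : ∀ {m} (f g : Fin m → ℕ) → (∀ x → f x ℕ.≤ g x) → sum f ℕ.≤ sum g
    sum-mono {zero} f g p = ℕ.z≤n
    sum-mono {suc m} f g p = ℕₚ.+-mono-≤ (p zero) (sum-mono (f ∘ suc) (g ∘ suc) (p ∘ suc))

    head≡ : f zero ≡ g zero
    head≡ = ℕₚ.≤-antisym (f≤g zero) (ℕₚ.+-cancelʳ-≤ (sum (f ∘ suc)) _ _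
      (subst (g zero ℕ.+ sum (f ∘ suc) ℕ.≤_) (sym eq)
        (ℕₚ.+-monoʳ-≤ (g zero) (sum-mono _ _ (f≤g ∘ suc)))))

  -- The points not fixed by an involution pair up, say x with f x where x < f x.
  involution-parity : ∀ {n} (f : Fin n → Fin n) → (∀ x → f (f x) ≡ x) →
    (w : Fin n → ℕ) → (∀ x → w (f x) ≡ w x) →
    ∃ λ m → sum w ≡ (m ℕ.+ m) ℕ.+ sum (λ x → [ f x ≟ x ] ℕ.* w x)
  involution-parity f ff w wf = sum lower , (begin
      sum w
        ≡⟨ sum-cong-≗ split ⟩
      sum (λ x → (lower x ℕ.+ upper x) ℕ.+ fixed x)
        ≡⟨ ∑-distrib-+ _ fixed ⟩
      sum (λ x → lower x ℕ.+ upper x) ℕ.+ sum fixed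
        ≡⟨ cong (ℕ._+ sum fixed) (∑-distrib-+ lower upper) ⟩
      (sum lower ℕ.+ sum upper) ℕ.+ sum fixed
        ≡⟨ cong (λ s → (sum lower ℕ.+ s) ℕ.+ sum fixed) upper≡lower ⟩
      (sum lower ℕ.+ sum lower) ℕ.+ sum fixed ∎)
    where
    open ≡-Reasoning
    lower upper fixed : Fin _ → ℕ
    lower x = [ x <? f x ] ℕ.* w x
    upper x = [ f x <? x ] ℕ.* w x
    fixed x = [ f x ≟ x ] ℕ.* w x

    upper≡lower : sum upper ≡ sum lower
    upper≡lower = trans (sym (sum-reindex f f ff ff upper))
      (sum-cong-≗ (λ x → cong₂ ℕ._*_ (cong (λ y → [ y <? f x ]) (ff x)) (wf x)))

    split : ∀ x → w x ≡ (lower x ℕ.+ upper x) ℕ.+ fixed x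
    split x with <-cmp x (f x)
    ... | tri< a ¬b ¬c
      rewrite []-true (x <? f x) a | []-false (f x <? x) ¬c | []-false (f x ≟ x) (¬b ∘ sym)
      = sym (trans (ℕₚ.+-identityʳ _) (trans (ℕₚ.+-identityʳ _) (ℕₚ.+-identityʳ _)))
    ... | tri≈ ¬a b ¬c
      rewrite []-false (x <? f x) ¬a | []-false (f x <? x) ¬c | []-true (f x ≟ x) (sym b)
      = sym (ℕₚ.+-identityʳ _)
    ... | tri> ¬a ¬b c
      rewrite []-false (x <? f x) ¬a | []-true (f x <? x) c | []-false (f x ≟ x) (¬b ∘ sym)
      = sym (trans (ℕₚ.+-identityʳ _) (ℕₚ.+-identityʳ _))

-- Integers as coefficients in a commutative ring

module IntegerCoefficients {A : Set} {_+_ _*_ : A → A → A} { -_ : A → A} {0# 1# : A}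
  (isCR : IsCommutativeRing _≡_ _+_ _*_ -_ 0# 1#) where

  commutativeRing : CommutativeRing 0ℓ 0ℓ
  commutativeRing = record { isCommutativeRing = isCR }

  open CommutativeRing commutativeRing using (ring; semiring; +-group; -‿inverseʳ; +-identityʳ; +-comm; +-assoc)
  open import Algebra.Properties.Semiring.Mult.TCOptimised semiring
    using (×-homo-+; ×1-homo-*; 1+×) renaming (_×_ to _·_)
  open import Algebra.Properties.Ring ring using (-‿distribˡ-*; -‿distribʳ-*; -0#≈0#; -‿involutive)
  open import Algebra.Solver.Ring.AlmostCommutativeRing using (AlmostCommutativeRing; fromCommutativeRing; _-Raw-AlmostCommutative⟶_)

  -- The multiple `_·_` is the variant in which `1 · x` reduces to `x`, so that `ι (pos 1)` is `1#`
  -- by computation.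
  ι : ℤ → A
  ι (pos n) = n · 1#
  ι -[1+ n ] = - (suc n · 1#)

  ι-neg : ∀ i → ι (ℤ.- i) ≡ - ι i
  ι-neg (pos zero) = sym -0#≈0#
  ι-neg (pos (suc n)) = refl
  ι-neg -[1+ n ] = sym (-‿involutive _)

  private
    module R = AlmostCommutativeRing (fromCommutativeRing commutativeRing)

    cancel : ∀ a x y → (a + x) + (- (a + y)) ≡ x + (- y)
    cancel a x y = begin
      (a + x) + (- (a + y))         ≡⟨ cong (λ z → (a + x) + z) (sym (R.-‿+-comm a y)) ⟩
      (a + x) + ((- a) + (- y))     ≡⟨ cong (λ z → z + ((- a) + (- y))) (+-comm a x) ⟩
      (x + a) + ((- a) + (- y))     ≡⟨ +-assoc x a _ ⟩
      x + (a + ((- a) + (- y)))     ≡⟨ cong (λ z → x + z) (sym (+-assoc a (- a) (- y))) ⟩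
      x + ((a + (- a)) + (- y))     ≡⟨ cong (λ z → x + (z + (- y))) (-‿inverseʳ a) ⟩
      x + (0# + (- y))              ≡⟨ cong (λ z → x + z) (R.+-identityˡ (- y)) ⟩
      x + (- y) ∎
      where open ≡-Reasoning

  ι-⊖ : ∀ m n → ι (m ℤ.⊖ n) ≡ (m · 1#) + (- (n · 1#))
  ι-⊖ m zero = sym (trans (cong (λ z → (m · 1#) + z) -0#≈0#) (+-identityʳ _))
  ι-⊖ zero (suc n) = sym (R.+-identityˡ _)
  ι-⊖ (suc m) (suc n) = begin
    ι (suc m ℤ.⊖ suc n)                        ≡⟨ cong ι (ℤₚ.[1+m]⊖[1+n]≡m⊖n m n) ⟩
    ι (m ℤ.⊖ n)                                ≡⟨ ι-⊖ m n ⟩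
    (m · 1#) + (- (n · 1#))                    ≡⟨ sym (cancel 1# _ _) ⟩
    (1# + (m · 1#)) + (- (1# + (n · 1#)))      ≡⟨ sym (cong₂ (λ x y → x + (- y)) (1+× m 1#) (1+× n 1#)) ⟩
    (suc m · 1#) + (- (suc n · 1#)) ∎
    where open ≡-Reasoning

  ι-+ : ∀ i j → ι (i ℤ.+ j) ≡ ι i + ι j
  ι-+ (pos m) (pos n) = ×-homo-+ 1# m n
  ι-+ (pos m) -[1+ n ] = ι-⊖ m (suc n)
  ι-+ -[1+ m ] (pos n) = trans (ι-⊖ n (suc m)) (+-comm _ _)
  ι-+ -[1+ m ] -[1+ n ] = trans (cong -_ (trans (cong (_· 1#) (sym (cong suc (ℕₚ.+-suc m n)))) (×-homo-+ 1# (suc m) (suc n))))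
                                (sym (R.-‿+-comm _ _))
    where import Data.Nat.Properties as ℕₚ

  ι-*-pos : ∀ m j → ι ((pos m) ℤ.* j) ≡ (ι (pos m) * ι j)
  ι-*-pos m (pos n) = trans (cong ι (sym (ℤₚ.pos-* m n))) (×1-homo-* m n)
  ι-*-pos m -[1+ n ] = begin
    ι ((pos m) ℤ.* (ℤ.- (pos (suc n))))   ≡⟨ cong ι (sym (ℤₚ.neg-distribʳ-* (pos m) (pos (suc n)))) ⟩
    ι (ℤ.- ((pos m) ℤ.* (pos (suc n))))   ≡⟨ ι-neg ((pos m) ℤ.* (pos (suc n))) ⟩
    - ι ((pos m) ℤ.* (pos (suc n)))       ≡⟨ cong -_ (ι-*-pos m (pos (suc n))) ⟩
    - (ι (pos m) * ι (pos (suc n)))       ≡⟨ -‿distribʳ-* _ _ ⟩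
    (ι (pos m) * (- ι (pos (suc n)))) ∎
    where open ≡-Reasoning

  ι-* : ∀ i j → ι (i ℤ.* j) ≡ (ι i * ι j)
  ι-* (pos m) j = ι-*-pos m j
  ι-* -[1+ m ] j = begin
    ι ((ℤ.- (pos (suc m))) ℤ.* j)   ≡⟨ cong ι (sym (ℤₚ.neg-distribˡ-* (pos (suc m)) j)) ⟩
    ι (ℤ.- ((pos (suc m)) ℤ.* j))   ≡⟨ ι-neg ((pos (suc m)) ℤ.* j) ⟩
    - ι ((pos (suc m)) ℤ.* j)       ≡⟨ cong -_ (ι-*-pos (suc m) j) ⟩
    - (ι (pos (suc m)) * ι j)       ≡⟨ -‿distribˡ-* _ _ ⟩
    ((- ι (pos (suc m))) * ι j) ∎
    where open ≡-Reasoning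

  morphism : ℤ.+-*-rawRing -Raw-AlmostCommutative⟶ fromCommutativeRing commutativeRing
  morphism = record
    { ⟦_⟧ = ι ; +-homo = ι-+ ; *-homo = ι-* ; -‿homo = ι-neg ; 0-homo = refl ; 1-homo = refl }

  open import Algebra.Solver.Ring ℤ.+-*-rawRing (fromCommutativeRing commutativeRing) morphism
    (λ i j → map (cong ι) (dec⇒maybe (i ℤₚ.≟ j))) public
    using (solve; con; _:+_; _:*_; :-_; _:-_; _:=_; _:^_)

-- Field arithmetic, squares and nonsquares

module FieldProperties {q : ℕ} (F : FieldOn q) where
  open FieldOn F using (0≢1; inverse; isCommRing)
  open IntegerCoefficients isCommRing public
  open CommutativeRing commutativeRing public
    using (_+_; _*_; -_; 0#; 1#; +-identityˡ; +-identityʳ; +-comm; *-identityˡ; *-identityʳ;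
           *-comm; zeroˡ; zeroʳ; isCommutativeSemiring)

  -- The default value 0 at 0 makes `inv` an involution of the whole field, so that sums can be
  -- reindexed along it.
  inv : Fin q → Fin q
  inv x with x ≟ 0#
  ... | yes _ = 0#
  ... | no x≢0 = proj₁ (inverse x x≢0)

  *-inv : ∀ {x} → x ≢ 0# → x * inv x ≡ 1#
  *-inv {x} x≢0 with x ≟ 0#
  ... | yes x≡0 = contradiction x≡0 x≢0
  ... | no x≢0 = proj₂ (inverse x x≢0)

  *-cancel : ∀ {a x y} → a ≢ 0# → a * x ≡ a * y → x ≡ y
  *-cancel {a} {x} {y} a≢0 eq = trans (sym (undo x)) (trans (cong (inv a *_) eq) (undo y))
    where
    undo : ∀ z → inv a * (a * z) ≡ z
    undo z = trans (solve 3 (λ a b z → b :* (a :* z) := (a :* b) :* z) refl a (inv a) z)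
                   (trans (cong (_* z) (*-inv a≢0)) (*-identityˡ z))

  *-nonzero : ∀ {x y} → x ≢ 0# → y ≢ 0# → x * y ≢ 0#
  *-nonzero {x} x≢0 y≢0 eq = y≢0 (*-cancel x≢0 (trans eq (sym (zeroʳ x))))

  *≡0 : ∀ {x y} → x * y ≡ 0# → x ≡ 0# ⊎ y ≡ 0#
  *≡0 {x} eq with x ≟ 0#
  ... | yes x≡0 = inj₁ x≡0
  ... | no x≢0 = inj₂ (*-cancel x≢0 (trans eq (sym (zeroʳ x))))

  inv-unique : ∀ {x y} → x * y ≡ 1# → inv x ≡ y
  inv-unique {x} {y} xy≡1 = *-cancel x≢0 (trans (*-inv x≢0) (sym xy≡1))
    where
    x≢0 : x ≢ 0#
    x≢0 x≡0 = 0≢1 (trans (sym (zeroˡ y)) (trans (cong (_* y) (sym x≡0)) xy≡1))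

  inv-nonzero : ∀ {x} → x ≢ 0# → inv x ≢ 0#
  inv-nonzero {x} x≢0 eq = 0≢1 (trans (sym (zeroʳ x)) (trans (cong (x *_) (sym eq)) (*-inv x≢0)))

  inv-involutive : ∀ x → inv (inv x) ≡ x
  inv-involutive x with x ≟ 0#
  ... | no x≢0 = inv-unique (trans (*-comm _ x) (proj₂ (inverse x x≢0)))
  ... | yes x≡0 with 0# ≟ 0#
  ...   | yes _ = sym x≡0
  ...   | no 0≢0 = contradiction refl 0≢0

  x-y≡0⇒x≡y : ∀ {x y} → x + - y ≡ 0# → x ≡ y
  x-y≡0⇒x≡y {x} {y} eq = trans (solve 2 (λ x y → x := (x :+ :- y) :+ y) refl x y)
                               (trans (cong (_+ y) eq) (+-identityˡ y))

  x≡y⇒x-y≡0 : ∀ {x y} → x ≡ y → x + - y ≡ 0#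
  x≡y⇒x-y≡0 {x} refl = solve 1 (λ x → x :+ :- x := con (pos 0)) refl x

  x+y≡0⇒x≡-y : ∀ {x y} → x + y ≡ 0# → x ≡ - y
  x+y≡0⇒x≡-y {x} {y} eq = trans (solve 2 (λ x y → x := (x :+ y) :+ :- y) refl x y)
                                (trans (cong (_+ - y) eq) (+-identityˡ (- y)))

  neg-involutive : ∀ x → - (- x) ≡ x
  neg-involutive = solve 1 (λ x → :- (:- x) := x) refl

  neg-nonzero : ∀ {x} → x ≢ 0# → - x ≢ 0#
  neg-nonzero {x} x≢0 eq = x≢0 (trans (sym (neg-involutive x)) (trans (cong -_ eq)
    (solve 0 (:- con (pos 0) := con (pos 0)) refl)))

  x²≡y²⇒x≡±y : ∀ {x y} → x * x ≡ y * y → x ≡ y ⊎ x ≡ - y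
  x²≡y²⇒x≡±y {x} {y} eq with *≡0 {x + - y} {x + y} (trans
    (solve 2 (λ x y → (x :+ :- y) :* (x :+ y) := (x :* x) :+ :- (y :* y)) refl x y) (x≡y⇒x-y≡0 eq))
  ... | inj₁ p = inj₁ (x-y≡0⇒x≡y p)
  ... | inj₂ p = inj₂ (x+y≡0⇒x≡-y p)

  neg1* : ∀ x → - x ≡ x * - 1#
  neg1* = solve 1 (λ x → :- x := x :* (:- con (pos 1))) refl

  Square NonSquare : Fin q → Set
  Square = IsSquare F
  NonSquare x = ¬ Square x

  abstract
    square? : ∀ x → Dec (Square x)
    square? x = ¬? (x ≟ 0#) ×-dec any? (λ y → y * y ≟ x)

  square-nonzero : ∀ {x} → Square x → x ≢ 0#
  square-nonzero = proj₁

  ¬square-0 : ¬ Square 0#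
  ¬square-0 s = square-nonzero s refl

  square-x² : ∀ {x} → x ≢ 0# → Square (x * x)
  square-x² {x} x≢0 = *-nonzero x≢0 x≢0 , x , refl

  square-1 : Square 1#
  square-1 = (λ eq → 0≢1 (sym eq)) , 1# , *-identityˡ 1#

  square-* : ∀ {x y} → Square x → Square y → Square (x * y)
  square-* (x≢0 , a , refl) (y≢0 , b , refl) = *-nonzero x≢0 y≢0 , a * b ,
    solve 2 (λ a b → (a :* b) :* (a :* b) := (a :* a) :* (b :* b)) refl a b

  square-inv : ∀ {x} → Square x → Square (inv x)
  square-inv {x} (x≢0 , a , refl) = inv-nonzero x≢0 , inv a ,
      sym (inv-unique (trans (solve 2 (λ a b → (a :* a) :* (b :* b) := (a :* b) :* (a :* b)) refl a (inv a))
        (trans (cong₂ _*_ (*-inv a≢0) (*-inv a≢0)) (*-identityˡ 1#))))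
    where
    a≢0 : a ≢ 0#
    a≢0 refl = x≢0 (zeroˡ _)

  square-cancel : ∀ {x y} → Square x → Square (x * y) → Square y
  square-cancel {x} {y} sx sxy = subst Square
    (trans (solve 3 (λ x i y → i :* (x :* y) := (x :* i) :* y) refl x (inv x) y)
      (trans (cong (_* y) (*-inv (square-nonzero sx))) (*-identityˡ y)))
    (square-* (square-inv sx) sxy)

  module OddOrder (odd : ∀ m → q ≢ m ℕ.+ m) where

    -- Otherwise x ↦ x + 1 would be an involution without fixed points.
    2≢0 : ι (pos 2) ≢ 0#
    2≢0 eq with involution-parity (_+ 1#)
        (λ x → trans (solve 1 (λ x → (x :+ con (pos 1)) :+ con (pos 1) := x :+ con (pos 2)) refl x)
                     (trans (cong (x +_) eq) (+-identityʳ x)))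
        (λ _ → 1) (λ _ → refl)
    ... | m , eq′ = odd m (trans (sym (sum-one q)) (trans eq′ (trans (cong (m ℕ.+ m ℕ.+_)
          (Count.sum-zero (λ x → cong (ℕ._* 1) (Count.[]-false (x + 1# ≟ x) (no-fixed x))))) (ℕₚ.+-identityʳ _))))
      where
      no-fixed : ∀ x → x + 1# ≢ x
      no-fixed x fx = 0≢1 (sym (trans (solve 1 (λ x → con (pos 1) := (x :+ con (pos 1)) :+ :- x) refl x) (x≡y⇒x-y≡0 fx)))

    x≢-x : ∀ {x} → x ≢ 0# → x ≢ - x
    x≢-x {x} x≢0 eq = *-nonzero 2≢0 x≢0
      (trans (solve 1 (λ x → con (pos 2) :* x := x :+ :- (:- x)) refl x) (x≡y⇒x-y≡0 eq))

    module RootCount {R : Set} {_⊕_ _⊗_ : R → R → R} {𝟘 𝟙 : R}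
                     (isCSR : IsCommutativeSemiring _≡_ _⊕_ _⊗_ 𝟘 𝟙) where
      open Sums isCSR
      open IsCommutativeSemiring isCSR using () renaming
        (*-identityʳ to ⊗-identityʳ; +-identityˡ to ⊕-identityˡ; +-identityʳ to ⊕-identityʳ)

      sum-[≟]₁ : ∀ (a : Fin q) → sum (λ x → [ x ≟ a ]) ≡ 𝟙
      sum-[≟]₁ a = trans (sum-cong-≗ (λ x → sym (⊗-identityʳ [ x ≟ a ]))) (sum-[≟] a (λ _ → 𝟙))

      -- The roots of a nonzero square are ±y, distinct in odd order. Stated over a semiring because
      -- the count is needed in ℕ for cardinalities and in the field for moments.
      sqrt-count : ∀ c → sum (λ z → [ z * z ≟ c ]) ≡ (([ square? c ] ⊕ [ square? c ]) ⊕ [ c ≟ 0# ])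
      sqrt-count c = helper (c ≟ 0#) (square? c)
        where
        open ≡-Reasoning
        helper : (z? : Dec (c ≡ 0#)) (s? : Dec (Square c)) →
                 sum (λ z → [ z * z ≟ c ]) ≡ (([ s? ] ⊕ [ s? ]) ⊕ [ z? ])
        helper (yes refl) (yes s) = contradiction s ¬square-0
        helper (yes refl) (no _) = begin
          sum (λ z → [ z * z ≟ 0# ])
            ≡⟨ sum-cong-≗ (λ z → []-cong (z * z ≟ 0#) (z ≟ 0#) ([ (λ e → e) , (λ e → e) ]′ ∘ *≡0) (λ { refl → zeroˡ _ })) ⟩
          sum (λ z → [ z ≟ 0# ])
            ≡⟨ sum-[≟]₁ 0# ⟩
          𝟙
            ≡⟨ sym (trans (cong (_⊕ 𝟙) (⊕-identityˡ 𝟘)) (⊕-identityˡ 𝟙)) ⟩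
          (𝟘 ⊕ 𝟘) ⊕ 𝟙 ∎
        helper (no c≢0) (no ¬s) = trans
          (sum-zero (λ z → []-false (z * z ≟ c) (λ eq → ¬s (c≢0 , z , eq))))
          (sym (trans (cong (_⊕ 𝟘) (⊕-identityˡ 𝟘)) (⊕-identityˡ 𝟘)))
        helper (no c≢0) (yes (_ , y , refl)) = begin
          sum (λ z → [ z * z ≟ y * y ])
            ≡⟨ sum-cong-≗ split ⟩
          sum (λ z → [ z ≟ y ] ⊕ [ z ≟ - y ])
            ≡⟨ ∑-distrib-+ (λ z → [ z ≟ y ]) (λ z → [ z ≟ - y ]) ⟩
          (sum (λ z → [ z ≟ y ]) ⊕ sum (λ z → [ z ≟ - y ]))
            ≡⟨ cong₂ _⊕_ (sum-[≟]₁ y) (sum-[≟]₁ (- y)) ⟩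
          𝟙 ⊕ 𝟙
            ≡⟨ sym (⊕-identityʳ _) ⟩
          (𝟙 ⊕ 𝟙) ⊕ 𝟘 ∎
          where
          y≢0 : y ≢ 0#
          y≢0 refl = c≢0 (zeroˡ _)
          split : ∀ z → [ z * z ≟ y * y ] ≡ ([ z ≟ y ] ⊕ [ z ≟ - y ])
          split z with z ≟ y | z ≟ - y
          ... | yes refl | yes eq = contradiction eq (x≢-x y≢0)
          ... | yes refl | no _ = trans ([]-true (z * z ≟ z * z) refl) (sym (⊕-identityʳ 𝟙))
          ... | no _ | yes refl = trans ([]-true (z * z ≟ y * y) (solve 1 (λ y → (:- y) :* (:- y) := y :* y) refl y)) (sym (⊕-identityˡ 𝟙))
          ... | no z≢y | no z≢-y = trans ([]-false (z * z ≟ y * y) ([ z≢y , z≢-y ]′ ∘ x²≡y²⇒x≡±y)) (sym (⊕-identityˡ 𝟘))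

    open Count
    open RootCount ℕₚ.+-*-isCommutativeSemiring using (sqrt-count; sum-[≟]₁)

    #squares : ℕ
    #squares = sum (λ x → [ square? x ])

    q≡2#squares+1 : q ≡ (#squares ℕ.+ #squares) ℕ.+ 1
    q≡2#squares+1 = begin
      q                                          ≡⟨ sym (sum-one q) ⟩
      sum {q} (λ _ → 1)                          ≡⟨ sum-cong-≗ (λ z → sym (trans
        (sum-cong-≗ (λ c → []-cong (z * z ≟ c) (c ≟ z * z) sym sym)) (sum-[≟]₁ (z * z)))) ⟩
      sum (λ z → sum (λ c → [ z * z ≟ c ]))      ≡⟨ ∑-comm (λ z c → [ z * z ≟ c ]) ⟩
      sum (λ c → sum (λ z → [ z * z ≟ c ]))      ≡⟨ sum-cong-≗ sqrt-count ⟩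
      sum (λ c → ([ square? c ] ℕ.+ [ square? c ]) ℕ.+ [ c ≟ 0# ])
        ≡⟨ ∑-distrib-+ _ (λ c → [ c ≟ 0# ]) ⟩
      sum (λ c → [ square? c ] ℕ.+ [ square? c ]) ℕ.+ sum (λ c → [ c ≟ 0# ])
        ≡⟨ cong₂ ℕ._+_ (∑-distrib-+ (λ c → [ square? c ]) (λ c → [ square? c ])) (sum-[≟]₁ 0#) ⟩
      (#squares ℕ.+ #squares) ℕ.+ 1 ∎
      where open ≡-Reasoning

    -- Multiplication by a nonsquare maps the squares injectively into the
    -- nonsquares, and there are equally many of both.
    nonsquare-mult : ∀ {a} → a ≢ 0# → NonSquare a → ∀ {x} → x ≢ 0# →
                     [ square? x ] ℕ.+ [ square? (a * x) ] ≡ 1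
    nonsquare-mult {a} a≢0 ¬sa {x} x≢0 = trans
      (trans (sym (ℕₚ.+-identityʳ _)) (cong (([ square? x ] ℕ.+ [ square? (a * x) ]) ℕ.+_)
        (sym ([]-false (x ≟ 0#) x≢0))))
      (≤∧sum≡⇒≡ f (λ _ → 1) f≤1 (trans sum-f (trans (sym q≡2#squares+1) (sym (sum-one q)))) x)
      where
      f : Fin q → ℕ
      f x = ([ square? x ] ℕ.+ [ square? (a * x) ]) ℕ.+ [ x ≟ 0# ]

      f≤1 : ∀ x → f x ℕ.≤ 1
      f≤1 x with x ≟ 0# | square? x | square? (a * x)
      ... | yes refl | yes s | _ = contradiction s ¬square-0
      ... | yes refl | no _ | yes s = contradiction (zeroʳ a) (square-nonzero s)
      ... | yes refl | no _ | no _ = ℕₚ.≤-refl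
      ... | no _ | yes s | yes s′ = contradiction (square-cancel s (subst Square (*-comm a x) s′)) ¬sa
      ... | no _ | yes _ | no _ = ℕₚ.≤-refl
      ... | no _ | no _ | yes _ = ℕₚ.≤-refl
      ... | no _ | no _ | no _ = ℕ.z≤n

      sum-f : sum f ≡ (#squares ℕ.+ #squares) ℕ.+ 1
      sum-f = trans (∑-distrib-+ _ (λ x → [ x ≟ 0# ])) (cong₂ ℕ._+_
        (trans (∑-distrib-+ (λ x → [ square? x ]) (λ x → [ square? (a * x) ]))
          (cong (#squares ℕ.+_) (sum-reindex (a *_) (inv a *_) (λ x → trans
              (solve 3 (λ a b x → a :* (b :* x) := (a :* b) :* x) refl a (inv a) x)
              (trans (cong (_* x) (*-inv a≢0)) (*-identityˡ x)))
            (λ x → trans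
              (solve 3 (λ a b x → b :* (a :* x) := (a :* b) :* x) refl a (inv a) x)
              (trans (cong (_* x) (*-inv a≢0)) (*-identityˡ x)))
            (λ x → [ square? x ]))))
        (sum-[≟]₁ 0#))

    nonsquare-* : ∀ {x y} → x ≢ 0# → NonSquare x → y ≢ 0# → NonSquare y → Square (x * y)
    nonsquare-* {x} {y} x≢0 ¬sx y≢0 ¬sy with square? y | square? (x * y) | nonsquare-mult x≢0 ¬sx y≢0
    ... | yes sy | _ | _ = contradiction sy ¬sy
    ... | no _ | yes s | _ = s

    -- Negation then permutes the squares without fixed points, so their number (q - 1)/2 is even.
    -1-square⇒4∣q-1 : Square (- 1#) → ∃ λ m → q ≡ (m ℕ.+ m) ℕ.+ (m ℕ.+ m) ℕ.+ 1
    -1-square⇒4∣q-1 s with involution-parity -_ neg-involutive (λ x → [ square? x ])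
        (λ x → []-cong (square? (- x)) (square? x)
          (λ s′ → square-cancel s (subst Square (trans (neg1* x) (*-comm x (- 1#))) s′))
          (λ s′ → subst Square (trans (*-comm (- 1#) x) (sym (neg1* x))) (square-* s s′)))
    ... | m , eq = m , trans q≡2#squares+1 (cong (λ n → n ℕ.+ n ℕ.+ 1)
        (trans eq (trans (cong (m ℕ.+ m ℕ.+_) (sum-zero no-fixed)) (ℕₚ.+-identityʳ _))))
      where
      no-fixed : ∀ x → [ - x ≟ x ] ℕ.* [ square? x ] ≡ 0
      no-fixed x with - x ≟ x | square? x
      ... | yes eq | yes s = contradiction (sym eq) (x≢-x (square-nonzero s))
      ... | yes _ | no _ = refl
      ... | no _ | _ = refl

    -- Inversion permutes the squares and fixes only ±1.
    -1-nonsquare⇒4∣q-3 : NonSquare (- 1#) → ∃ λ m → q ≡ (m ℕ.+ m ℕ.+ 1) ℕ.+ (m ℕ.+ m ℕ.+ 1) ℕ.+ 1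
    -1-nonsquare⇒4∣q-3 ¬s with involution-parity inv inv-involutive (λ x → [ square? x ])
        (λ x → []-cong (square? (inv x)) (square? x)
          (λ s → subst Square (inv-involutive x) (square-inv s)) square-inv)
    ... | m , eq = m , trans q≡2#squares+1 (cong (λ n → n ℕ.+ n ℕ.+ 1)
        (trans eq (cong (m ℕ.+ m ℕ.+_) (trans (sum-cong-≗ only-one) (sum-[≟]₁ 1#)))))
      where
      only-one : ∀ x → [ inv x ≟ x ] ℕ.* [ square? x ] ≡ [ x ≟ 1# ]
      only-one x with inv x ≟ x | square? x | x ≟ 1#
      ... | _ | no ¬s₁ | yes refl = contradiction square-1 ¬s₁
      ... | no i≢ | _ | yes refl = contradiction (inv-unique (*-identityˡ 1#)) i≢
      ... | yes _ | yes _ | yes _ = refl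
      ... | yes _ | no _ | no _ = refl
      ... | no _ | _ | no _ = refl
      ... | yes i≡ | yes s | no x≢1 with x²≡y²⇒x≡±y {x} {1#} (trans (cong (x *_) (sym i≡)) (trans (*-inv (square-nonzero s)) (sym (*-identityˡ 1#))))
      ...   | inj₁ x≡1 = contradiction x≡1 x≢1
      ...   | inj₂ refl = contradiction s ¬s

-- The base block and the hyperbola

module Base {q : ℕ} (F : FieldOn q) (odd : ∀ m → q ≢ m ℕ.+ m) (τ : Fin q) (τ≢0 : τ ≢ FieldOn.0F F) where
  open FieldProperties F public
  open OddOrder odd public

  2# 4# κ : Fin q
  2# = ι (pos 2)
  4# = ι (pos 4)
  abstract
    -- With x = κ(v + 2) the product x(x - τ) becomes κ²(v² - 4), a nonzero square times `disc v`.
    κ = inv 4# * τ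

  4≢0 : 4# ≢ 0#
  4≢0 eq = *-nonzero 2≢0 2≢0 (trans (solve 0 (con (pos 2) :* con (pos 2) := con (pos 4)) refl) eq)

  abstract
    4κ≡τ : 4# * κ ≡ τ
    4κ≡τ = trans (solve 3 (λ f i t → f :* (i :* t) := (f :* i) :* t) refl 4# (inv 4#) τ)
                 (trans (cong (_* τ) (*-inv 4≢0)) (*-identityˡ τ))

  κ≢0 : κ ≢ 0#
  κ≢0 eq = τ≢0 (trans (sym 4κ≡τ) (trans (cong (4# *_) eq) (zeroʳ 4#)))

  ½ : Fin q
  ½ = inv 2#

  2*½ : 2# * ½ ≡ 1#
  2*½ = *-inv 2≢0

  -- In the coordinate v the points 0 and τ become -2 and 2.
  point coord : Fin q → Fin q
  point v = κ * (v + 2#)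
  coord x = inv κ * x + - 2#

  point-coord : ∀ x → point (coord x) ≡ x
  point-coord x = trans (solve 3 (λ k i x → k :* ((i :* x :+ :- con (pos 2)) :+ con (pos 2)) := (k :* i) :* x) refl κ (inv κ) x)
                        (trans (cong (_* x) (*-inv κ≢0)) (*-identityˡ x))

  coord-point : ∀ v → coord (point v) ≡ v
  coord-point v = trans (solve 3 (λ k i v → (i :* (k :* (v :+ con (pos 2)))) :+ :- con (pos 2) := (k :* i) :* (v :+ con (pos 2)) :+ :- con (pos 2)) refl κ (inv κ) v)
    (trans (cong (λ z → z * (v + 2#) + - 2#) (*-inv κ≢0))
      (solve 1 (λ v → con (pos 1) :* (v :+ con (pos 2)) :+ :- con (pos 2) := v) refl v))

  point-τ : ∀ v → point v + - τ ≡ κ * (v + - 2#)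
  point-τ v = trans (cong (λ t → point v + - t) (sym 4κ≡τ))
    (solve 2 (λ k v → k :* (v :+ con (pos 2)) :+ :- (con (pos 4) :* k) := k :* (v :+ :- con (pos 2))) refl κ v)

  inShift⇔ : ∀ x → (InShift F τ x → Square (x + - τ)) × (Square (x + - τ) → InShift F τ x)
  inShift⇔ x = (λ { (y , s , refl) → subst Square (solve 2 (λ y t → y := (y :+ t) :+ :- t) refl y τ) s })
    , (λ s → x + - τ , s , solve 2 (λ x t → x := (x :+ :- t) :+ t) refl x τ)

  InBase : Fin q → Set
  InBase = InB F τ

  abstract
    inBase? : ∀ x → Dec (InBase x)
    inBase? x = (square? x ×-dec ¬? shift?) ⊎-dec (shift? ×-dec ¬? (square? x))
      where
      shift? : Dec (InShift F τ x)
      shift? with square? (x + - τ)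
      ... | yes s = yes (proj₂ (inShift⇔ x) s)
      ... | no ¬s = no (¬s ∘ proj₁ (inShift⇔ x))

  module Weights {R : Set} {_⊕_ _⊗_ : R → R → R} {𝟘 𝟙 : R}
                 (isCSR : IsCommutativeSemiring _≡_ _⊕_ _⊗_ 𝟘 𝟙) where
    open Sums isCSR public
    open RootCount isCSR
    open IsCommutativeSemiring isCSR using () renaming
      (*-identityʳ to ⊗-identityʳ; *-identityˡ to ⊗-identityˡ; +-identityˡ to ⊕-identityˡ; +-identityʳ to ⊕-identityʳ;
       zeroˡ to ⊗-zeroˡ)
    open import Algebra.Solver.Ring.NaturalCoefficients.Default commutativeSemiring
      using () renaming (solve to solveR; con to conR; _:+_ to _:⊕_; _:*_ to _:⊗_; _:=_ to _:≡_)
    open ≡-Reasoning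

    private
      both : ∀ {x} → Square x → Square (x + - τ) → [ inBase? x ] ≡ 𝟘
      both {x} s t = []-false (inBase? x) λ
        { (inj₁ (_ , ¬t)) → ¬t (proj₂ (inShift⇔ x) t) ; (inj₂ (_ , ¬s)) → ¬s s }
      none : ∀ {x} → ¬ Square x → ¬ Square (x + - τ) → [ inBase? x ] ≡ 𝟘
      none {x} ¬s ¬t = []-false (inBase? x) λ
        { (inj₁ (s , _)) → ¬s s ; (inj₂ (t , _)) → ¬t (proj₁ (inShift⇔ x) t) }
      first : ∀ {x} → Square x → ¬ Square (x + - τ) → [ inBase? x ] ≡ 𝟙
      first {x} s ¬t = []-true (inBase? x) (inj₁ (s , ¬t ∘ proj₁ (inShift⇔ x)))
      second : ∀ {x} → ¬ Square x → Square (x + - τ) → [ inBase? x ] ≡ 𝟙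
      second {x} ¬s t = []-true (inBase? x) (inj₂ (proj₂ (inShift⇔ x) t , ¬s))

    inBase-0 : [ inBase? 0# ] ≡ [ square? (- τ) ]
    inBase-0 with square? (- τ)
    ... | yes s = second ¬square-0 (subst Square (sym (+-identityˡ (- τ))) s)
    ... | no ¬s = none ¬square-0 (¬s ∘ subst Square (+-identityˡ (- τ)))

    inBase-τ : [ inBase? τ ] ≡ [ square? τ ]
    inBase-τ with square? τ
    ... | yes s = first s (λ t → square-nonzero t (x≡y⇒x-y≡0 refl))
    ... | no ¬s = none ¬s (λ t → square-nonzero t (x≡y⇒x-y≡0 refl))

    -- Away from 0 and τ, membership says that x and x - τ have different quadratic characters,
    -- which is to say that their product is a nonsquare.
    inBase-generic : ∀ {x} → x ≢ 0# → x + - τ ≢ 0# →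
                     ([ inBase? x ] ⊕ [ square? (x * (x + - τ)) ]) ≡ 𝟙
    inBase-generic {x} x≢0 y≢0 with square? x | square? (x + - τ)
    ... | yes s | yes t = trans (cong₂ _⊕_ (both s t) ([]-true (square? _) (square-* s t))) (⊕-identityˡ 𝟙)
    ... | yes s | no ¬t = trans (cong₂ _⊕_ (first s ¬t) ([]-false (square? _) (¬t ∘ square-cancel s))) (⊕-identityʳ 𝟙)
    ... | no ¬s | yes t = trans (cong₂ _⊕_ (second ¬s t) ([]-false (square? _) (λ st → ¬s (square-cancel t (subst Square (*-comm x _) st))))) (⊕-identityʳ 𝟙)
    ... | no ¬s | no ¬t = trans (cong₂ _⊕_ (none ¬s ¬t) ([]-true (square? _) (nonsquare-* x≢0 ¬s y≢0 ¬t))) (⊕-identityˡ 𝟙)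

    -- The discriminant of s² - vs + 1, whose roots have sum v and product 1.
    disc : Fin q → Fin q
    disc v = v * v + - 4#

    -- For v ≠ ±2 this is twice `inBase-generic`, since z² = `disc v` has 2 or 0 solutions. At v =
    -- ±2 there is the single solution z = 0; the extra indicator on the left raises it to 2, and
    -- the right side records whether the endpoint itself lies in the block.
    weight : ∀ v →
      ((([ inBase? (point v) ] ⊕ [ inBase? (point v) ]) ⊕ sum (λ z → [ z * z ≟ disc v ])) ⊕ ([ v ≟ 2# ] ⊕ [ v ≟ - 2# ]))
      ≡ ((𝟙 ⊕ 𝟙) ⊕ (([ v ≟ 2# ] ⊗ ([ square? τ ] ⊕ [ square? τ ])) ⊕ ([ v ≟ - 2# ] ⊗ ([ square? (- τ) ] ⊕ [ square? (- τ) ]))))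
    weight v = trans (cong (λ r → (([ inBase? (point v) ] ⊕ [ inBase? (point v) ]) ⊕ r) ⊕ ([ v ≟ 2# ] ⊕ [ v ≟ - 2# ])) (sqrt-count (disc v)))
                     (helper v (v ≟ 2#) (v ≟ - 2#))
      where
      helper : ∀ v (p : Dec (v ≡ 2#)) (m : Dec (v ≡ - 2#)) →
        ((([ inBase? (point v) ] ⊕ [ inBase? (point v) ]) ⊕ (([ square? (disc v) ] ⊕ [ square? (disc v) ]) ⊕ [ disc v ≟ 0# ])) ⊕ ([ p ] ⊕ [ m ]))
        ≡ ((𝟙 ⊕ 𝟙) ⊕ (([ p ] ⊗ ([ square? τ ] ⊕ [ square? τ ])) ⊕ ([ m ] ⊗ ([ square? (- τ) ] ⊕ [ square? (- τ) ]))))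
      helper v (yes refl) (yes 2≡-2) = contradiction 2≡-2 (x≢-x 2≢0)
      helper v (yes refl) (no _)
        rewrite trans (cong (λ x → [ inBase? x ]) (trans (solve 1 (λ k → k :* (con (pos 2) :+ con (pos 2)) := con (pos 4) :* k) refl κ) 4κ≡τ)) inBase-τ
              | []-false (square? (disc 2#)) (λ s → square-nonzero s (solve 0 (con (pos 2) :* con (pos 2) :+ :- con (pos 4) := con (pos 0)) refl))
              | []-true (disc 2# ≟ 0#) (solve 0 (con (pos 2) :* con (pos 2) :+ :- con (pos 4) := con (pos 0)) refl)
        = solveR 3 (λ s t u → ((s :⊕ s) :⊕ ((conR 0 :⊕ conR 0) :⊕ u)) :⊕ (u :⊕ conR 0) :≡ (u :⊕ u) :⊕ ((conR 1 :⊗ (s :⊕ s)) :⊕ (conR 0 :⊗ t))) refl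
            [ square? τ ] ([ square? (- τ) ] ⊕ [ square? (- τ) ]) 𝟙
      helper v (no _) (yes refl)
        rewrite trans (cong (λ x → [ inBase? x ]) (solve 1 (λ k → k :* ((:- con (pos 2)) :+ con (pos 2)) := con (pos 0)) refl κ)) inBase-0
              | []-false (square? (disc (- 2#))) (λ s → square-nonzero s (solve 0 ((:- con (pos 2)) :* (:- con (pos 2)) :+ :- con (pos 4) := con (pos 0)) refl))
              | []-true (disc (- 2#) ≟ 0#) (solve 0 ((:- con (pos 2)) :* (:- con (pos 2)) :+ :- con (pos 4) := con (pos 0)) refl)
        = solveR 3 (λ s t u → ((s :⊕ s) :⊕ ((conR 0 :⊕ conR 0) :⊕ u)) :⊕ (conR 0 :⊕ u) :≡ (u :⊕ u) :⊕ ((conR 0 :⊗ t) :⊕ (conR 1 :⊗ (s :⊕ s)))) refl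
            [ square? (- τ) ] ([ square? τ ] ⊕ [ square? τ ]) 𝟙
      helper v (no v≢2) (no v≢-2) = begin
        (((b ⊕ b) ⊕ ((s ⊕ s) ⊕ [ disc v ≟ 0# ])) ⊕ (𝟘 ⊕ 𝟘))
          ≡⟨ cong (λ z → ((b ⊕ b) ⊕ ((s ⊕ s) ⊕ z)) ⊕ (𝟘 ⊕ 𝟘)) ([]-false (disc v ≟ 0#) disc≢0) ⟩
        (((b ⊕ b) ⊕ ((s ⊕ s) ⊕ 𝟘)) ⊕ (𝟘 ⊕ 𝟘))
          ≡⟨ solveR 4 (λ b s t t′ → ((b :⊕ b) :⊕ ((s :⊕ s) :⊕ conR 0)) :⊕ (conR 0 :⊕ conR 0)
               :≡ ((b :⊕ s) :⊕ (b :⊕ s)) :⊕ ((conR 0 :⊗ t) :⊕ (conR 0 :⊗ t′))) refl b s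
               ([ square? τ ] ⊕ [ square? τ ]) ([ square? (- τ) ] ⊕ [ square? (- τ) ]) ⟩
        (((b ⊕ s) ⊕ (b ⊕ s)) ⊕ rest)
          ≡⟨ cong (λ z → (z ⊕ z) ⊕ rest) b⊕s ⟩
        ((𝟙 ⊕ 𝟙) ⊕ rest) ∎
        where
        b = [ inBase? (point v) ]
        s = [ square? (disc v) ]
        rest = (𝟘 ⊗ ([ square? τ ] ⊕ [ square? τ ])) ⊕ (𝟘 ⊗ ([ square? (- τ) ] ⊕ [ square? (- τ) ]))
        v+2≢0 : v + 2# ≢ 0#
        v+2≢0 = v≢-2 ∘ x+y≡0⇒x≡-y
        v-2≢0 : v + - 2# ≢ 0#
        v-2≢0 = v≢2 ∘ x-y≡0⇒x≡y
        disc≢0 : disc v ≢ 0#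
        disc≢0 eq = *-nonzero v+2≢0 v-2≢0 (trans
          (solve 1 (λ v → (v :+ con (pos 2)) :* (v :+ :- con (pos 2)) := v :* v :+ :- con (pos 4)) refl v) eq)
        product : point v * (point v + - τ) ≡ (κ * κ) * disc v
        product = trans (cong (point v *_) (point-τ v))
          (solve 2 (λ k v → (k :* (v :+ con (pos 2))) :* (k :* (v :+ :- con (pos 2))) := (k :* k) :* (v :* v :+ :- con (pos 4))) refl κ v)
        b⊕s : (b ⊕ s) ≡ 𝟙
        b⊕s = trans (cong (b ⊕_) (trans
            ([]-cong (square? (disc v)) (square? ((κ * κ) * disc v)) (square-* (square-x² κ≢0)) (square-cancel (square-x² κ≢0)))
            (cong (λ x → [ square? x ]) (sym product))))
          (inBase-generic (*-nonzero κ≢0 v+2≢0) (λ eq → *-nonzero κ≢0 v-2≢0 (trans (sym (point-τ v)) eq)))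

    nonzero? : ∀ (s : Fin q) → Dec (s ≢ 0#)
    nonzero? s = ¬? (s ≟ 0#)

    -- The substitution z = v - 2s turns the hyperbola z² = v² - 4 into s² - sv + 1 = 0.
    hyperbola : ∀ (h : Fin q → R) →
      sum (λ v → sum (λ z → [ z * z ≟ disc v ]) ⊗ h v) ≡ sum (λ s → [ nonzero? s ] ⊗ h (s + inv s))
    hyperbola h = begin
      sum (λ v → sum (λ z → [ z * z ≟ disc v ]) ⊗ h v)
        ≡⟨ sum-cong-≗ (λ v → *-distribʳ-sum (h v) (λ z → [ z * z ≟ disc v ])) ⟩
      sum (λ v → sum (λ z → [ z * z ≟ disc v ] ⊗ h v))
        ≡⟨ sum-cong-≗ (λ v → sym (sum-reindex (λ s → v + - (2# * s)) (λ z → ½ * (v + - z))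
             (λ z → trans (solve 4 (λ t v z i → v :+ :- (t :* (i :* (v :+ :- z))) := v :+ :- ((t :* i) :* (v :+ :- z))) refl 2# v z ½)
               (trans (cong (λ e → v + - (e * (v + - z))) 2*½) (solve 2 (λ v z → v :+ :- (con (pos 1) :* (v :+ :- z)) := z) refl v z)))
             (λ s → trans (solve 4 (λ t v s i → i :* (v :+ :- (v :+ :- (t :* s))) := (t :* i) :* s) refl 2# v s ½)
               (trans (cong (_* s) 2*½) (*-identityˡ s)))
             (λ z → [ z * z ≟ disc v ] ⊗ h v))) ⟩
      sum (λ v → sum (λ s → [ (v + - (2# * s)) * (v + - (2# * s)) ≟ disc v ] ⊗ h v))
        ≡⟨ ∑-comm (λ v s → [ (v + - (2# * s)) * (v + - (2# * s)) ≟ disc v ] ⊗ h v) ⟩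
      sum (λ s → sum (λ v → [ (v + - (2# * s)) * (v + - (2# * s)) ≟ disc v ] ⊗ h v))
        ≡⟨ sum-cong-≗ (λ s → inner s (s ≟ 0#)) ⟩
      sum (λ s → [ nonzero? s ] ⊗ h (s + inv s)) ∎
      where
      on-hyperbola : ∀ {s v} → (v + - (2# * s)) * (v + - (2# * s)) ≡ disc v → s * v ≡ s * s + 1#
      on-hyperbola {s} {v} eq = *-cancel 4≢0 (x-y≡0⇒x≡y (trans
        (solve 2 (λ s v → con (pos 4) :* (s :* v) :+ :- (con (pos 4) :* (s :* s :+ con (pos 1)))
           := (v :* v :+ :- con (pos 4)) :+ :- ((v :+ :- (con (pos 2) :* s)) :* (v :+ :- (con (pos 2) :* s)))) refl s v)
        (x≡y⇒x-y≡0 (sym eq))))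

      s*[s+inv-s] : ∀ {s} → s ≢ 0# → s * (s + inv s) ≡ s * s + 1#
      s*[s+inv-s] {s} s≢0 = trans (solve 2 (λ s i → s :* (s :+ i) := s :* s :+ s :* i) refl s (inv s)) (cong (s * s +_) (*-inv s≢0))

      inner : ∀ s (d : Dec (s ≡ 0#)) →
        sum (λ v → [ (v + - (2# * s)) * (v + - (2# * s)) ≟ disc v ] ⊗ h v) ≡ ([ ¬? d ] ⊗ h (s + inv s))
      -- At s = 0 the equation s v = s² + 1 reads 0 = 1, so there is no term; for s ≠ 0 it has the
      -- single solution v = s + 1/s.
      inner s (yes refl) = trans
        (sum-zero (λ v → trans (cong (_⊗ h v) ([]-false (_ ≟ disc v) (λ eq → 0≢1′ (trans
           (sym (zeroˡ v)) (trans (on-hyperbola {0#} {v} eq) (solve 0 (con (pos 0) :* con (pos 0) :+ con (pos 1) := con (pos 1)) refl))))))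
           (⊗-zeroˡ (h v))))
        (sym (⊗-zeroˡ (h (0# + inv 0#))))
        where
        0≢1′ : 0# ≢ 1#
        0≢1′ = FieldOn.0≢1 F
      inner s (no s≢0) = trans
        (sum-[unique] (λ v → (v + - (2# * s)) * (v + - (2# * s)) ≟ disc v) (s + inv s)
          (trans (solve 2 (λ s v → (v :+ :- (con (pos 2) :* s)) :* (v :+ :- (con (pos 2) :* s))
               := (v :* v :+ :- con (pos 4)) :+ con (pos 4) :* ((s :* s :+ con (pos 1)) :+ :- (s :* v))) refl s (s + inv s))
            (trans (cong (λ z → disc (s + inv s) + 4# * z) (x≡y⇒x-y≡0 (sym (s*[s+inv-s] s≢0))))
              (trans (cong (disc (s + inv s) +_) (zeroʳ 4#)) (+-identityʳ _))))
          (λ eq → *-cancel s≢0 (trans (on-hyperbola eq) (sym (s*[s+inv-s] s≢0))))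
          h)
        (sym (⊗-identityˡ (h (s + inv s))))

    base-sum hyperbola-sum : (Fin q → R) → R
    base-sum h = sum (λ v → [ inBase? (point v) ] ⊗ h v)
    hyperbola-sum h = sum (λ s → [ nonzero? s ] ⊗ h (s + inv s))

    -- The identity `weight` summed against `h`. Over ℕ with `h` constantly 1 it gives the block
    -- size; over the field with `h v = v ^ j` it gives the moments.
    base-sum-formula : ∀ h →
      (((base-sum h ⊕ base-sum h) ⊕ hyperbola-sum h) ⊕ (h 2# ⊕ h (- 2#)))
      ≡ ((sum h ⊕ sum h) ⊕ ((([ square? τ ] ⊕ [ square? τ ]) ⊗ h 2#) ⊕ (([ square? (- τ) ] ⊕ [ square? (- τ) ]) ⊗ h (- 2#))))
    base-sum-formula h = begin
      (((base-sum h ⊕ base-sum h) ⊕ hyperbola-sum h) ⊕ (h 2# ⊕ h (- 2#)))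
        ≡⟨ cong₂ (λ x y → ((base-sum h ⊕ base-sum h) ⊕ x) ⊕ y) (sym (hyperbola h)) (cong₂ _⊕_ (sym (sum-[≟] 2# h)) (sym (sum-[≟] (- 2#) h))) ⟩
      (((sum B ⊕ sum B) ⊕ sum C) ⊕ (sum P ⊕ sum M))
        ≡⟨ sym (trans (∑-distrib-+ (λ v → (B v ⊕ B v) ⊕ C v) (λ v → P v ⊕ M v))
             (cong₂ _⊕_ (trans (∑-distrib-+ (λ v → B v ⊕ B v) C) (cong (_⊕ sum C) (∑-distrib-+ B B))) (∑-distrib-+ P M))) ⟩
      sum (λ v → ((B v ⊕ B v) ⊕ C v) ⊕ (P v ⊕ M v))
        ≡⟨ sum-cong-≗ pointwise ⟩
      sum (λ v → (h v ⊕ h v) ⊕ ((t ⊗ P v) ⊕ (t′ ⊗ M v)))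
        ≡⟨ trans (∑-distrib-+ (λ v → h v ⊕ h v) (λ v → (t ⊗ P v) ⊕ (t′ ⊗ M v)))
             (cong₂ _⊕_ (∑-distrib-+ h h) (trans (∑-distrib-+ (λ v → t ⊗ P v) (λ v → t′ ⊗ M v))
               (sym (cong₂ _⊕_ (*-distribˡ-sum t P) (*-distribˡ-sum t′ M))))) ⟩
      ((sum h ⊕ sum h) ⊕ ((t ⊗ sum P) ⊕ (t′ ⊗ sum M)))
        ≡⟨ cong₂ (λ x y → (sum h ⊕ sum h) ⊕ ((t ⊗ x) ⊕ (t′ ⊗ y))) (sum-[≟] 2# h) (sum-[≟] (- 2#) h) ⟩
      ((sum h ⊕ sum h) ⊕ ((t ⊗ h 2#) ⊕ (t′ ⊗ h (- 2#)))) ∎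
      where
      B C P M : Fin q → R
      B v = [ inBase? (point v) ] ⊗ h v
      C v = sum (λ z → [ z * z ≟ disc v ]) ⊗ h v
      P v = [ v ≟ 2# ] ⊗ h v
      M v = [ v ≟ - 2# ] ⊗ h v
      t = [ square? τ ] ⊕ [ square? τ ]
      t′ = [ square? (- τ) ] ⊕ [ square? (- τ) ]
      pointwise : ∀ v → (((B v ⊕ B v) ⊕ C v) ⊕ (P v ⊕ M v)) ≡ ((h v ⊕ h v) ⊕ ((t ⊗ P v) ⊕ (t′ ⊗ M v)))
      pointwise v = trans
        (solveR 5 (λ b c p m h → ((b :⊗ h :⊕ b :⊗ h) :⊕ c :⊗ h) :⊕ (p :⊗ h :⊕ m :⊗ h) :≡ (((b :⊕ b) :⊕ c) :⊕ (p :⊕ m)) :⊗ h) refl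
          [ inBase? (point v) ] (sum (λ z → [ z * z ≟ disc v ])) [ v ≟ 2# ] [ v ≟ - 2# ] (h v))
        (trans (cong (_⊗ h v) (weight v))
        (trans (solveR 6 (λ u p m t t′ h → ((u :⊕ u) :⊕ (p :⊗ t :⊕ m :⊗ t′)) :⊗ h :≡ (u :⊗ h :⊕ u :⊗ h) :⊕ (t :⊗ (p :⊗ h) :⊕ t′ :⊗ (m :⊗ h))) refl
          𝟙 [ v ≟ 2# ] [ v ≟ - 2# ] t t′ (h v))
          (cong (λ z → (z ⊕ z) ⊕ ((t ⊗ P v) ⊕ (t′ ⊗ M v))) (⊗-identityˡ (h v)))))

-- Roots of polynomials and power sums

module PowerSums {q : ℕ} (F : FieldOn q) where
  open FieldProperties F
  open CommutativeRing commutativeRing using (semiring)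
  open import Algebra.Properties.Semiring.Exp semiring public using (_^_)
  open Sums isCommutativeSemiring
  open FieldOn F using (0≢1)

  -- x ↦ c₀ + c₁ x + … + c_{d-1} x^{d-1} + x^d
  monic : ∀ {d} → Vec (Fin q) d → Fin q → Fin q
  monic [] x = 1#
  monic (c ∷ cs) x = c + x * monic cs x

  -- Horner's scheme: dividing by x - a, the coefficients of the quotient are the values at a of the
  -- successive tails.
  quotient : ∀ {d} → Fin q → Vec (Fin q) (suc d) → Vec (Fin q) d
  quotient a (c ∷ []) = []
  quotient a (c ∷ cs@(_ ∷ _)) = monic cs a ∷ quotient a cs

  monic-quotient : ∀ {d} a (cs : Vec (Fin q) (suc d)) x →
    monic cs x ≡ monic cs a + (x + - a) * monic (quotient a cs) x
  monic-quotient a (c ∷ []) x = solve 3 (λ c a x →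
    c :+ x :* con (pos 1) := (c :+ a :* con (pos 1)) :+ (x :+ :- a) :* con (pos 1)) refl c a x
  monic-quotient a (c ∷ cs@(_ ∷ _)) x = trans
    (cong (λ z → c + x * z) (monic-quotient a cs x))
    (solve 5 (λ c a x m r → c :+ x :* (m :+ (x :+ :- a) :* r) := (c :+ a :* m) :+ (x :+ :- a) :* (m :+ x :* r))
      refl c a x (monic cs a) (monic (quotient a cs) x))

  -- Splitting off the root a leaves the other listed elements, which differ from a, as roots of the
  -- quotient.
  #roots≤degree : ∀ {d} (cs : Vec (Fin q) d) (as : List (Fin q)) → Unique as →
                  All (λ a → monic cs a ≡ 0#) as → length as ℕ.≤ d
  #roots≤degree cs [] _ _ = ℕ.z≤n
  #roots≤degree [] (a ∷ as) _ (root ∷ _) = contradiction (sym root) 0≢1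
  #roots≤degree cs@(_ ∷ _) (a ∷ as) (a≢ ∷ unique) (root ∷ roots) =
    ℕ.s≤s (#roots≤degree (quotient a cs) as unique (All.zipWith quotient-root (a≢ , roots)))
    where
    quotient-root : ∀ {b} → (a ≢ b) × (monic cs b ≡ 0#) → monic (quotient a cs) b ≡ 0#
    quotient-root {b} (a≢b , root-b) with *≡0 {b + - a} {monic (quotient a cs) b} (begin
        (b + - a) * monic (quotient a cs) b                 ≡⟨ sym (+-identityˡ _) ⟩
        0# + (b + - a) * monic (quotient a cs) b            ≡⟨ cong (_+ (b + - a) * monic (quotient a cs) b) (sym root) ⟩
        monic cs a + (b + - a) * monic (quotient a cs) b    ≡⟨ sym (monic-quotient a cs b) ⟩
        monic cs b                                          ≡⟨ root-b ⟩
        0# ∎)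
      where open ≡-Reasoning
    ... | inj₁ b-a≡0 = contradiction (sym (x-y≡0⇒x≡y b-a≡0)) a≢b
    ... | inj₂ r = r

  monic-replicate : ∀ n x → monic (Vec.replicate n 0#) x ≡ x ^ n
  monic-replicate zero x = refl
  monic-replicate (suc n) x = trans (+-identityˡ _) (cong (x *_) (monic-replicate n x))

  -- Otherwise x^(j+1) - x would vanish on all of F.
  ∃-non-root-of-unity : ∀ j → suc (suc j) ℕ.< q → ∃ λ c → c ≢ 0# × c ^ suc j ≢ 1#
  ∃-non-root-of-unity j j<q with ¬∀⟶∃¬ q (λ c → c ≢ 0# → c ^ suc j ≡ 1#)
      (λ c → ¬? (c ≟ 0#) →-dec (c ^ suc j ≟ 1#)) ¬all
    where
    poly : Vec (Fin q) (suc (suc j))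
    -- This is x^(j+2) - x: the factor x also takes in 0, so all q elements become roots, against
    -- the degree j + 2 < q.
    poly = 0# ∷ - 1# ∷ Vec.replicate j 0#
    ¬all : ¬ (∀ c → c ≢ 0# → c ^ suc j ≡ 1#)
    ¬all all = ℕₚ.<⇒≱ j<q (subst (ℕ._≤ suc (suc j)) (length-tabulate (λ x → x))
      (#roots≤degree poly (allFin q) (Uniqueₚ.allFin⁺ q) (All.universal root (allFin q))))
      where
      root : ∀ c → monic poly c ≡ 0#
      root c with c ≟ 0#
      ... | yes refl = trans (+-identityˡ _) (zeroˡ _)
      ... | no c≢0 = begin
        0# + c * (- 1# + c * monic (Vec.replicate j 0#) c)  ≡⟨ cong (λ z → 0# + c * (- 1# + c * z)) (monic-replicate j c) ⟩
        0# + c * (- 1# + c ^ suc j)                         ≡⟨ cong (λ z → 0# + c * (- 1# + z)) (all c c≢0) ⟩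
        0# + c * (- 1# + 1#)                                ≡⟨ solve 1 (λ c → con (pos 0) :+ c :* (:- con (pos 1) :+ con (pos 1)) := con (pos 0)) refl c ⟩
        0# ∎
        where open ≡-Reasoning
  ... | c , ¬imp = c , (λ c≡0 → ¬imp (λ c≢0 → contradiction c≡0 c≢0)) , (λ eq → ¬imp (λ _ → eq))

  ^-distrib-* : ∀ x y n → (x * y) ^ n ≡ x ^ n * y ^ n
  ^-distrib-* x y zero = sym (*-identityˡ 1#)
  ^-distrib-* x y (suc n) = trans (cong ((x * y) *_) (^-distrib-* x y n))
    (solve 4 (λ x y a b → (x :* y) :* (a :* b) := (x :* a) :* (y :* b)) refl x y (x ^ n) (y ^ n))

  -- The translation v ↦ v + 1 permutes the field, so Σ v = Σ v + Σ 1.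
  sum-1≡0 : sum {q} (λ _ → 1#) ≡ 0#
  sum-1≡0 = begin
    sum {q} (λ _ → 1#)  ≡⟨ solve 2 (λ s i → s := (i :+ s) :+ :- i) refl (sum {q} (λ _ → 1#)) (sum {q} (λ v → v)) ⟩
    (sum {q} (λ v → v) + sum {q} (λ _ → 1#)) + - sum {q} (λ v → v)
      ≡⟨ cong (_+ - sum {q} (λ v → v)) (trans (sym (∑-distrib-+ (λ v → v) (λ _ → 1#)))
           (sum-reindex (_+ 1#) (_+ - 1#)
             (solve 1 (λ x → (x :+ :- con (pos 1)) :+ con (pos 1) := x) refl)
             (solve 1 (λ x → (x :+ con (pos 1)) :+ :- con (pos 1) := x) refl) (λ v → v))) ⟩
    sum {q} (λ v → v) + - sum {q} (λ v → v) ≡⟨ x≡y⇒x-y≡0 refl ⟩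
    0# ∎
    where open ≡-Reasoning

  -- Scaling by some c with c^j ≠ 1 permutes the field but multiplies the sum by c^j. The exponent 0
  -- is separate, with 0^0 = 1.
  power-sum : ∀ j → suc j ℕ.< q → sum (λ v → v ^ j) ≡ 0#
  power-sum zero _ = sum-1≡0
  power-sum (suc j) j<q with ∃-non-root-of-unity j j<q
  ... | c , c≢0 , c^j≢1 with *≡0 {c ^ suc j + - 1#} {sum (λ v → v ^ suc j)} (begin
        (c ^ suc j + - 1#) * S      ≡⟨ solve 2 (λ c s → (c :+ :- con (pos 1)) :* s := c :* s :+ :- s) refl (c ^ suc j) S ⟩
        c ^ suc j * S + - S         ≡⟨ x≡y⇒x-y≡0 scaled ⟩
        0# ∎)
    where
    open ≡-Reasoning
    S = sum (λ v → v ^ suc j)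
    scaled : c ^ suc j * S ≡ S
    scaled = begin
      c ^ suc j * S                      ≡⟨ *-distribˡ-sum (c ^ suc j) (λ v → v ^ suc j) ⟩
      sum (λ v → c ^ suc j * v ^ suc j)  ≡⟨ sum-cong-≗ (λ v → sym (^-distrib-* c v (suc j))) ⟩
      sum (λ v → (c * v) ^ suc j)        ≡⟨ sum-reindex (c *_) (inv c *_)
        (λ x → trans (solve 3 (λ a b x → a :* (b :* x) := (a :* b) :* x) refl c (inv c) x)
              (trans (cong (_* x) (*-inv c≢0)) (*-identityˡ x)))
        (λ x → trans (solve 3 (λ a b x → b :* (a :* x) := (a :* b) :* x) refl c (inv c) x)
              (trans (cong (_* x) (*-inv c≢0)) (*-identityˡ x))) (λ v → v ^ suc j) ⟩
      S ∎
  ...   | inj₁ eq = contradiction (x-y≡0⇒x≡y eq) c^j≢1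
  ...   | inj₂ eq = eq

-- Moments of the base block

-- laurent j i is the value of Σ_{s≠0} (s + s⁻¹)^j s^i in every field with
-- more than i + j + 1 elements.
laurent : ℕ → ℕ → ℤ
laurent zero zero = ℤ.- pos 1
laurent zero (suc i) = pos 0
laurent (suc j) zero = laurent j 1 ℤ.+ laurent j 1
laurent (suc j) (suc i) = laurent j (suc (suc i)) ℤ.+ laurent j i

-- The parameters are the quadratic characters of τ and -τ, each twice the square indicator minus 1;
-- they weigh the endpoints v = 2 and v = -2. Moments are integers here, so that their values at
-- concrete exponents hold by computation.
module MomentDefs (e₁ e₂ : ℤ) where
  -- The j-th moment Σ v^j over the base block, doubled.
  moment : ℕ → ℤ
  moment j = (ℤ.- laurent j 0) ℤ.+ (e₁ ℤ.* (pos 2) ℤ.^ j ℤ.+ e₂ ℤ.* (ℤ.- pos 2) ℤ.^ j)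

  -- Likewise for (v + c)^j v^i.
  shifted : ℤ → ℕ → ℕ → ℤ
  shifted c zero i = moment i
  shifted c (suc j) i = shifted c j (suc i) ℤ.+ c ℤ.* shifted c j i

module Moments {q : ℕ} (F : FieldOn q) (odd : ∀ m → q ≢ m ℕ.+ m) (τ : Fin q) (τ≢0 : τ ≢ FieldOn.0F F) where
  open Base F odd τ τ≢0 public
  open PowerSums F public
  open Weights isCommutativeSemiring public

  laurent-sum : ℕ → ℕ → Fin q
  laurent-sum j i = sum (λ s → [ nonzero? s ] * ((s + inv s) ^ j * s ^ i))

  -- One factor s + 1/s is expanded at a time. At i = 0 the term with 1/s is turned into one with s
  -- by the substitution s ↦ 1/s, so negative exponents never persist. Each step keeps j + i or
  -- lowers it, so the bound carries over.
  laurent-sum≡ : ∀ j i → suc (j ℕ.+ i) ℕ.< q → laurent-sum j i ≡ ι (laurent j i)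
  laurent-sum≡ zero zero lt = begin
    laurent-sum 0 0
      ≡⟨ solve 2 (λ x y → x := (x :+ y) :+ :- y) refl (laurent-sum 0 0) (sum (λ (s : Fin q) → [ s ≟ 0# ] * 1#)) ⟩
    (laurent-sum 0 0 + sum (λ (s : Fin q) → [ s ≟ 0# ] * 1#)) + - sum (λ (s : Fin q) → [ s ≟ 0# ] * 1#)
      ≡⟨ cong₂ (λ x y → x + - y)
           (trans (sym (∑-distrib-+ (λ s → [ nonzero? s ] * (1# * 1#)) (λ s → [ s ≟ 0# ] * 1#)))
             (trans (sum-cong-≗ total) sum-1≡0))
           (sum-[≟] 0# (λ _ → 1#)) ⟩
    0# + - 1#
      ≡⟨ +-identityˡ (- 1#) ⟩
    - 1# ∎
    where
    open ≡-Reasoning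
    total : ∀ s → [ nonzero? s ] * (1# * 1#) + [ s ≟ 0# ] * 1# ≡ 1#
    total s with s ≟ 0#
    ... | yes _ = solve 0 (con (pos 0) :* (con (pos 1) :* con (pos 1)) :+ con (pos 1) :* con (pos 1) := con (pos 1)) refl
    ... | no _ = solve 0 (con (pos 1) :* (con (pos 1) :* con (pos 1)) :+ con (pos 0) :* con (pos 1) := con (pos 1)) refl
  laurent-sum≡ zero (suc i) lt = trans (sum-cong-≗ drop) (power-sum (suc i) lt)
    where
    drop : ∀ s → [ nonzero? s ] * (1# * s ^ suc i) ≡ s ^ suc i
    drop s with s ≟ 0#
    ... | yes refl = trans (zeroˡ _) (sym (zeroˡ _))
    ... | no _ = trans (*-identityˡ _) (*-identityˡ _)
  laurent-sum≡ (suc j) zero lt = begin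
    laurent-sum (suc j) 0
      ≡⟨ sum-cong-≗ (λ s → solve 4 (λ n s i p → n :* (((s :+ i) :* p) :* con (pos 1)) := n :* (p :* (s :* con (pos 1))) :+ n :* (p :* (i :* con (pos 1)))) refl
           [ nonzero? s ] s (inv s) ((s + inv s) ^ j)) ⟩
    sum (λ s → [ nonzero? s ] * ((s + inv s) ^ j * s ^ 1) + [ nonzero? s ] * ((s + inv s) ^ j * inv s ^ 1))
      ≡⟨ ∑-distrib-+ (λ s → [ nonzero? s ] * ((s + inv s) ^ j * s ^ 1)) (λ s → [ nonzero? s ] * ((s + inv s) ^ j * inv s ^ 1)) ⟩
    laurent-sum j 1 + sum (λ s → [ nonzero? s ] * ((s + inv s) ^ j * inv s ^ 1))
      ≡⟨ cong (laurent-sum j 1 +_) (trans (sum-cong-≗ flip)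
           (sum-reindex inv inv inv-involutive inv-involutive (λ s → [ nonzero? s ] * ((s + inv s) ^ j * s ^ 1)))) ⟩
    laurent-sum j 1 + laurent-sum j 1
      ≡⟨ cong₂ _+_ IH IH ⟩
    ι (laurent j 1) + ι (laurent j 1)
      ≡⟨ sym (ι-+ (laurent j 1) (laurent j 1)) ⟩
    ι (laurent (suc j) 0) ∎
    where
    open ≡-Reasoning
    IH : laurent-sum j 1 ≡ ι (laurent j 1)
    IH = laurent-sum≡ j 1 (subst (λ n → suc n ℕ.< q) (sym (ℕₚ.+-suc j 0)) lt)
    flip : ∀ s → [ nonzero? s ] * ((s + inv s) ^ j * inv s ^ 1) ≡ [ nonzero? (inv s) ] * ((inv s + inv (inv s)) ^ j * inv s ^ 1)
    flip s = cong₂ _*_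
      ([]-cong (nonzero? s) (nonzero? (inv s)) inv-nonzero (λ i≢0 → subst (_≢ 0#) (inv-involutive s) (inv-nonzero i≢0)))
      (cong (λ z → z ^ j * inv s ^ 1) (trans (+-comm s (inv s)) (cong (inv s +_) (sym (inv-involutive s)))))
  laurent-sum≡ (suc j) (suc i) lt = begin
    laurent-sum (suc j) (suc i)
      ≡⟨ sum-cong-≗ (λ s → split s (s ≟ 0#)) ⟩
    sum (λ s → [ nonzero? s ] * ((s + inv s) ^ j * s ^ suc (suc i)) + [ nonzero? s ] * ((s + inv s) ^ j * s ^ i))
      ≡⟨ ∑-distrib-+ (λ s → [ nonzero? s ] * ((s + inv s) ^ j * s ^ suc (suc i))) (λ s → [ nonzero? s ] * ((s + inv s) ^ j * s ^ i)) ⟩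
    laurent-sum j (suc (suc i)) + laurent-sum j i
      ≡⟨ cong₂ _+_
           (laurent-sum≡ j (suc (suc i)) (subst (λ n → suc n ℕ.< q) (sym (ℕₚ.+-suc j (suc i))) lt))
           (laurent-sum≡ j i (ℕₚ.<-trans (ℕ.s≤s (ℕ.s≤s (ℕₚ.+-monoʳ-≤ j (ℕₚ.n≤1+n i)))) lt)) ⟩
    ι (laurent j (suc (suc i))) + ι (laurent j i)
      ≡⟨ sym (ι-+ (laurent j (suc (suc i))) (laurent j i)) ⟩
    ι (laurent (suc j) (suc i)) ∎
    where
    open ≡-Reasoning
    split : ∀ s (d : Dec (s ≡ 0#)) → [ ¬? d ] * ((s + inv s) ^ suc j * s ^ suc i)
              ≡ [ ¬? d ] * ((s + inv s) ^ j * s ^ suc (suc i)) + [ ¬? d ] * ((s + inv s) ^ j * s ^ i)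
    split s (yes _) = solve 3 (λ a b c → con (pos 0) :* a := con (pos 0) :* b :+ con (pos 0) :* c) refl _ _ _
    split s (no s≢0) = begin
      1# * (((s + inv s) * P) * (s * s ^ i))
        ≡⟨ solve 4 (λ s i p m → con (pos 1) :* (((s :+ i) :* p) :* (s :* m)) := con (pos 1) :* (p :* (s :* (s :* m))) :+ con (pos 1) :* (p :* ((s :* i) :* m))) refl s (inv s) P (s ^ i) ⟩
      1# * (P * (s * (s * s ^ i))) + 1# * (P * ((s * inv s) * s ^ i))
        ≡⟨ cong (λ z → 1# * (P * (s * (s * s ^ i))) + 1# * (P * z)) (trans (cong (_* s ^ i) (*-inv s≢0)) (*-identityˡ _)) ⟩
      1# * (P * (s * (s * s ^ i))) + 1# * (P * s ^ i) ∎
      where P = (s + inv s) ^ j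

  ι-^ : ∀ i n → ι (i ℤ.^ n) ≡ ι i ^ n
  ι-^ i zero = refl
  ι-^ i (suc n) = trans (ι-* i (i ℤ.^ n)) (cong (ι i *_) (ι-^ i n))

  abstract
    -- Twice the sum over the block, because `base-sum-formula` yields the double.
    𝔼 : (Fin q → Fin q) → Fin q
    𝔼 h = base-sum h + base-sum h

    𝔼-def : ∀ h → 𝔼 h ≡ base-sum h + base-sum h
    𝔼-def h = refl

    𝔼-cong : ∀ {f g} → (∀ v → f v ≡ g v) → 𝔼 f ≡ 𝔼 g
    𝔼-cong {f} {g} f≗g = cong₂ _+_ eq eq
      where
      eq : base-sum f ≡ base-sum g
      eq = sum-cong-≗ (λ v → cong ([ inBase? (point v) ] *_) (f≗g v))

    𝔼-linear : ∀ a b f g → 𝔼 (λ v → a * f v + b * g v) ≡ a * 𝔼 f + b * 𝔼 g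
    𝔼-linear a b f g = trans (cong (λ z → z + z) eq)
        (solve 4 (λ a b f g → (a :* f :+ b :* g) :+ (a :* f :+ b :* g) := a :* (f :+ f) :+ b :* (g :+ g)) refl a b (base-sum f) (base-sum g))
      where
      eq : base-sum (λ v → a * f v + b * g v) ≡ a * base-sum f + b * base-sum g
      eq = begin
        base-sum (λ v → a * f v + b * g v)
          ≡⟨ sum-cong-≗ (λ v → solve 5 (λ w a b f g → w :* (a :* f :+ b :* g) := a :* (w :* f) :+ b :* (w :* g)) refl [ inBase? (point v) ] a b (f v) (g v)) ⟩
        sum (λ v → a * ([ inBase? (point v) ] * f v) + b * ([ inBase? (point v) ] * g v))
          ≡⟨ ∑-distrib-+ (λ v → a * ([ inBase? (point v) ] * f v)) (λ v → b * ([ inBase? (point v) ] * g v)) ⟩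
        sum (λ v → a * ([ inBase? (point v) ] * f v)) + sum (λ v → b * ([ inBase? (point v) ] * g v))
          ≡⟨ sym (cong₂ _+_ (*-distribˡ-sum a (λ v → [ inBase? (point v) ] * f v)) (*-distribˡ-sum b (λ v → [ inBase? (point v) ] * g v))) ⟩
        a * base-sum f + b * base-sum g ∎
        where open ≡-Reasoning

  module _ (e₁ e₂ : ℤ) (τ-sign : [ square? τ ] + [ square? τ ] ≡ ι e₁ + 1#)
                       (-τ-sign : [ square? (- τ) ] + [ square? (- τ) ] ≡ ι e₂ + 1#) where
    open MomentDefs e₁ e₂

    -- In this range Σ v^j over the whole field vanishes, which leaves the hyperbola and the
    -- endpoints v = ±2.
    𝔼-^ : ∀ j → suc j ℕ.< q → 𝔼 (λ v → v ^ j) ≡ ι (moment j)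
    𝔼-^ j lt = begin
      𝔼 h
        ≡⟨ 𝔼-def h ⟩
      base-sum h + base-sum h
        ≡⟨ solve 3 (λ b g p → b := ((b :+ g) :+ p) :+ :- (g :+ p)) refl (base-sum h + base-sum h) (hyperbola-sum h) (h 2# + h (- 2#)) ⟩
      (((base-sum h + base-sum h) + hyperbola-sum h) + (h 2# + h (- 2#))) + - (hyperbola-sum h + (h 2# + h (- 2#)))
        ≡⟨ cong₂ (λ x y → x + - (y + (h 2# + h (- 2#))))
             (trans (base-sum-formula h) (cong₂ _+_ (cong₂ _+_ (power-sum j lt) (power-sum j lt)) (cong₂ (λ x y → x * h 2# + y * h (- 2#)) τ-sign -τ-sign)))
             (trans (sum-cong-≗ (λ s → cong ([ nonzero? s ] *_) (sym (*-identityʳ ((s + inv s) ^ j)))))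
               (laurent-sum≡ j 0 (subst (λ n → suc n ℕ.< q) (sym (ℕₚ.+-identityʳ j)) lt))) ⟩
      ((0# + 0#) + ((ι e₁ + 1#) * h 2# + (ι e₂ + 1#) * h (- 2#))) + - (ι (laurent j 0) + (h 2# + h (- 2#)))
        ≡⟨ solve 5 (λ e e′ p m k → ((con (pos 0) :+ con (pos 0)) :+ ((e :+ con (pos 1)) :* p :+ (e′ :+ con (pos 1)) :* m)) :+ :- (k :+ (p :+ m))
             := (:- k) :+ (e :* p :+ e′ :* m)) refl (ι e₁) (ι e₂) (h 2#) (h (- 2#)) (ι (laurent j 0)) ⟩
      - ι (laurent j 0) + (ι e₁ * h 2# + ι e₂ * h (- 2#))
        ≡⟨ sym (trans (ι-+ (ℤ.- laurent j 0) _) (cong₂ _+_ (ι-neg (laurent j 0)) (trans (ι-+ (e₁ ℤ.* _) (e₂ ℤ.* _))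
             (cong₂ _+_ (trans (ι-* e₁ _) (cong (ι e₁ *_) (ι-^ (pos 2) j))) (trans (ι-* e₂ _) (cong (ι e₂ *_) (ι-^ (ℤ.- pos 2) j))))))) ⟩
      ι (moment j) ∎
      where
      open ≡-Reasoning
      h : Fin q → Fin q
      h v = v ^ j

    𝔼-shifted : ∀ c j i → suc (j ℕ.+ i) ℕ.< q → 𝔼 (λ v → (v + ι c) ^ j * v ^ i) ≡ ι (shifted c j i)
    𝔼-shifted c zero i lt = trans (𝔼-cong (λ v → *-identityˡ (v ^ i))) (𝔼-^ i lt)
    𝔼-shifted c (suc j) i lt = begin
      𝔼 (λ v → ((v + ι c) * (v + ι c) ^ j) * v ^ i)
        ≡⟨ 𝔼-cong (λ v → solve 4 (λ v c p m → ((v :+ c) :* p) :* m := con (pos 1) :* (p :* (v :* m)) :+ c :* (p :* m)) refl v (ι c) ((v + ι c) ^ j) (v ^ i)) ⟩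
      𝔼 (λ v → 1# * ((v + ι c) ^ j * v ^ suc i) + ι c * ((v + ι c) ^ j * v ^ i))
        ≡⟨ 𝔼-linear 1# (ι c) (λ v → (v + ι c) ^ j * v ^ suc i) (λ v → (v + ι c) ^ j * v ^ i) ⟩
      1# * 𝔼 (λ v → (v + ι c) ^ j * v ^ suc i) + ι c * 𝔼 (λ v → (v + ι c) ^ j * v ^ i)
        ≡⟨ cong₂ (λ x y → x + ι c * y)
             (trans (*-identityˡ _) (𝔼-shifted c j (suc i) (subst (λ n → suc n ℕ.< q) (sym (ℕₚ.+-suc j i)) lt)))
             (𝔼-shifted c j i (ℕₚ.<-trans (ℕₚ.n<1+n _) lt)) ⟩
      ι (shifted c j (suc i)) + ι c * ι (shifted c j i)
        ≡⟨ sym (trans (ι-+ (shifted c j (suc i)) _) (cong (ι (shifted c j (suc i)) +_) (ι-* c (shifted c j i)))) ⟩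
      ι (shifted c (suc j) i) ∎
      where open ≡-Reasoning

-- The affine stabiliser of the base block

module Stabiliser {q : ℕ} (F : FieldOn q) (odd : ∀ m → q ≢ m ℕ.+ m) (τ : Fin q) (τ≢0 : τ ≢ FieldOn.0F F) where
  open Moments F odd τ τ≢0
  open ≡-Reasoning
  open CommutativeRing commutativeRing using (semiring)
  open import Algebra.Properties.Semiring.Exp semiring using (^-homo-*)

  module _ (α β : Fin q) (α≢0 : α ≢ 0#)
      (stable : ∀ v → InBase (point v) → InBase (point (α * v + β)))
      (stable⁻¹ : ∀ v → InBase (point (α * v + β)) → InBase (point v)) where

    𝔼-invariant : ∀ h → 𝔼 (λ v → h (α * v + β)) ≡ 𝔼 h
    𝔼-invariant h = trans (𝔼-def _) (trans (cong (λ z → z + z) eq) (sym (𝔼-def h)))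
      where
      eq : base-sum (λ v → h (α * v + β)) ≡ base-sum h
      eq = trans (sum-cong-≗ (λ v → cong (_* h (α * v + β))
                   ([]-cong (inBase? (point v)) (inBase? (point (α * v + β))) (stable v) (stable⁻¹ v))))
        (sum-reindex (λ v → α * v + β) (λ w → inv α * (w + - β))
          (λ w → trans (solve 4 (λ a i w b → a :* (i :* (w :+ :- b)) :+ b := (a :* i) :* (w :+ :- b) :+ b) refl α (inv α) w β)
            (trans (cong (λ z → z * (w + - β) + β) (*-inv α≢0)) (solve 2 (λ w b → con (pos 1) :* (w :+ :- b) :+ b := w) refl w β)))
          (λ v → trans (solve 4 (λ a i v b → i :* ((a :* v :+ b) :+ :- b) := (a :* i) :* v) refl α (inv α) v β)
            (trans (cong (_* v) (*-inv α≢0)) (*-identityˡ v)))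
          (λ v → [ inBase? (point v) ] * h v))

    ι-≢0-* : ∀ m n → ι m ≢ 0# → ι n ≢ 0# → ι (m ℤ.* n) ≢ 0#
    ι-≢0-* m n m≢0 n≢0 eq = *-nonzero m≢0 n≢0 (trans (sym (ι-* m n)) eq)

    ι-≢0-neg : ∀ m → ι m ≢ 0# → ι (neg m) ≢ 0#
    ι-≢0-neg m m≢0 eq = neg-nonzero m≢0 (trans (sym (ι-neg m)) eq)

    -- u and v are Bézout coefficients for n and the characteristic p.
    ι-coprime : ∀ p n u v → ι p ≡ 0# → u ℤ.* n ℤ.+ v ℤ.* p ≡ pos 1 → ι n ≢ 0#
    ι-coprime p n u v p≡0 bezout n≡0 = FieldOn.0≢1 F (begin
      0#                      ≡⟨ solve 2 (λ u v → con (pos 0) := u :* con (pos 0) :+ v :* con (pos 0)) refl (ι u) (ι v) ⟩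
      ι u * 0# + ι v * 0#     ≡⟨ cong₂ (λ x y → ι u * x + ι v * y) (sym n≡0) (sym p≡0) ⟩
      ι u * ι n + ι v * ι p   ≡⟨ sym (trans (ι-+ (u ℤ.* n) (v ℤ.* p)) (cong₂ _+_ (ι-* u n) (ι-* v p))) ⟩
      ι (u ℤ.* n ℤ.+ v ℤ.* p) ≡⟨ cong ι bezout ⟩
      1# ∎)

    ι-mod : ∀ p n r k → ι p ≡ 0# → n ≡ r ℤ.+ k ℤ.* p → ι n ≡ ι r
    ι-mod p n r k p≡0 refl = begin
      ι (r ℤ.+ k ℤ.* p)    ≡⟨ trans (ι-+ r (k ℤ.* p)) (cong (ι r +_) (ι-* k p)) ⟩
      ι r + ι k * ι p      ≡⟨ cong (λ z → ι r + ι k * z) p≡0 ⟩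
      ι r + ι k * 0#       ≡⟨ solve 2 (λ r k → r :+ k :* con (pos 0) := r) refl (ι r) (ι k) ⟩
      ι r ∎

    α²≡1⇒α≡±1 : α ^ 2 ≡ 1# → α ≡ 1# ⊎ α ≡ - 1#
    α²≡1⇒α≡±1 eq = x²≡y²⇒x≡±y (trans (solve 1 (λ a → a :* a := a :^ 2) refl α) (trans eq (sym (*-identityˡ 1#))))

    -- One subtractive step of Euclid's algorithm on exponents; repeated, it passes from two
    -- exponents to their greatest common divisor.
    α^[m+n]≡1 : ∀ m n → α ^ m ≡ 1# → α ^ (m ℕ.+ n) ≡ 1# → α ^ n ≡ 1#
    α^[m+n]≡1 m n α^m α^m+n = begin
      α ^ n             ≡⟨ sym (*-identityˡ _) ⟩
      1# * α ^ n        ≡⟨ cong (_* α ^ n) (sym α^m) ⟩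
      α ^ m * α ^ n     ≡⟨ sym (^-homo-* α m n) ⟩
      α ^ (m ℕ.+ n)     ≡⟨ α^m+n ⟩
      1# ∎

    module _ (e₁ e₂ : ℤ) (τ-sign : [ square? τ ] + [ square? τ ] ≡ ι e₁ + 1#)
                         (-τ-sign : [ square? (- τ) ] + [ square? (- τ) ] ≡ ι e₂ + 1#) where
      open MomentDefs e₁ e₂

      -- The stabiliser fixes the barycentre -c, so that v ↦ αv + β becomes
      -- multiplication by α on the central moments.
      module Centred (c : ℤ) (centre : shifted c 1 0 ≡ pos 0) (m₀≢0 : ι (moment 0) ≢ 0#) (2<q : 2 ℕ.< q) where

        private
          m₁ : 𝔼 (λ v → v + ι c) ≡ 0#
          m₁ = trans (𝔼-cong (λ v → sym (trans (*-identityʳ _) (*-identityʳ _))))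
                     (trans (𝔼-shifted e₁ e₂ τ-sign -τ-sign c 1 0 2<q) (cong ι centre))

        -- The left side is the displacement of -c under the map. The first central moment is 0 and
        -- invariant, yet the map adds to it the displacement times the zeroth moment, which is
        -- nonzero.
        β-centred : β + ι c + - (α * ι c) ≡ 0#
        β-centred = [ (λ eq → eq) , (λ eq → contradiction eq m₀≢0) ]′ (*≡0 {δ} {ι (moment 0)} (begin
            δ * ι (moment 0)
              ≡⟨ trans (sym (+-identityˡ _)) (cong₂ _+_ (sym (zeroʳ α)) refl) ⟩
            α * 0# + δ * ι (moment 0)
              ≡⟨ sym (cong₂ (λ x y → α * x + δ * y) m₁ (𝔼-^ e₁ e₂ τ-sign -τ-sign 0 (ℕₚ.<-trans (ℕₚ.n<1+n 1) 2<q))) ⟩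
            α * 𝔼 (λ v → v + ι c) + δ * 𝔼 (λ v → v ^ 0)
              ≡⟨ sym (𝔼-linear α δ (λ v → v + ι c) (λ v → v ^ 0)) ⟩
            𝔼 (λ v → α * (v + ι c) + δ * 1#)
              ≡⟨ 𝔼-cong (λ v → solve 4 (λ a b v c → a :* (v :+ c) :+ ((b :+ c) :+ :- (a :* c)) :* con (pos 1)
                   := (a :* v :+ b) :+ c) refl α β v (ι c)) ⟩
            𝔼 (λ v → α * v + β + ι c)
              ≡⟨ 𝔼-invariant (λ v → v + ι c) ⟩
            𝔼 (λ v → v + ι c)
              ≡⟨ m₁ ⟩
            0# ∎))
          where
          δ : Fin q
          δ = β + ι c + - (α * ι c)

        α^j≡1 : ∀ j → suc j ℕ.< q → ι (shifted c j 0) ≢ 0# → α ^ j ≡ 1#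
        α^j≡1 j lt mⱼ≢0 = [ x-y≡0⇒x≡y , (λ eq → contradiction eq mⱼ≢0) ]′ (*≡0 {α ^ j + - 1#} {m} (begin
            (α ^ j + - 1#) * m
              -- The summand with coefficient 0 only supplies the two-term shape that `𝔼-linear`
              -- expects.
              ≡⟨ solve 2 (λ a m → (a :+ :- con (pos 1)) :* m := (a :* m :+ con (pos 0) :* m) :+ :- m) refl (α ^ j) m ⟩
            (α ^ j * m + 0# * m) + - m
              ≡⟨ x≡y⇒x-y≡0 scaled ⟩
            0# ∎))
          where
          m : Fin q
          m = ι (shifted c j 0)
          h : Fin q → Fin q
          h v = (v + ι c) ^ j * v ^ 0
          𝔼h : 𝔼 h ≡ m
          𝔼h = 𝔼-shifted e₁ e₂ τ-sign -τ-sign c j 0 (subst (λ n → suc n ℕ.< q) (sym (ℕₚ.+-identityʳ j)) lt)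
          scaled : α ^ j * m + 0# * m ≡ m
          scaled = begin
            α ^ j * m + 0# * m          ≡⟨ cong₂ (λ x y → α ^ j * x + 0# * y) (sym 𝔼h) (sym 𝔼h) ⟩
            α ^ j * 𝔼 h + 0# * 𝔼 h      ≡⟨ sym (𝔼-linear (α ^ j) 0# h h) ⟩
            𝔼 (λ v → α ^ j * h v + 0# * h v)
              ≡⟨ 𝔼-cong (λ v → begin
                   α ^ j * ((v + ι c) ^ j * 1#) + 0# * ((v + ι c) ^ j * 1#)
                     ≡⟨ solve 2 (λ a b → a :* (b :* con (pos 1)) :+ con (pos 0) :* (b :* con (pos 1)) := (a :* b) :* con (pos 1)) refl (α ^ j) ((v + ι c) ^ j) ⟩
                   (α ^ j * (v + ι c) ^ j) * 1#
                     ≡⟨ cong (_* 1#) (trans (sym (^-distrib-* α (v + ι c) j)) (cong (_^ j) (affine v))) ⟩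
                   (α * v + β + ι c) ^ j * 1# ∎) ⟩
            𝔼 (λ v → h (α * v + β))     ≡⟨ 𝔼-invariant h ⟩
            𝔼 h                         ≡⟨ 𝔼h ⟩
            m ∎
            where
            affine : ∀ v → α * (v + ι c) ≡ α * v + β + ι c
            affine v = trans (sym (+-identityʳ _)) (trans (cong (α * (v + ι c) +_) (sym β-centred))
              (solve 4 (λ a b v c → a :* (v :+ c) :+ ((b :+ c) :+ :- (a :* c)) := (a :* v :+ b) :+ c) refl α β v (ι c)))

      -- Sparse polynomials as pairs of coefficient and exponent. They expand powers of αv + β
      -- directly where no centre is available.
      polynomial : List (Fin q × ℕ) → Fin q → Fin q
      polynomial [] v = 0#
      polynomial ((c , k) ∷ p) v = c * v ^ k + 1# * polynomial p v

      expectation : List (Fin q × ℕ) → Fin q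
      expectation [] = 0#
      expectation ((c , k) ∷ p) = c * ι (moment k) + expectation p

      𝔼-polynomial : ∀ p → All (λ ck → suc (proj₂ ck) ℕ.< q) p → 𝔼 (polynomial p) ≡ expectation p
      𝔼-polynomial [] [] = begin
        𝔼 (λ _ → 0#)                              ≡⟨ 𝔼-cong (λ _ → solve 0 (con (pos 0) := con (pos 0) :* con (pos 0) :+ con (pos 0) :* con (pos 0)) refl) ⟩
        𝔼 (λ _ → 0# * 0# + 0# * 0#)               ≡⟨ 𝔼-linear 0# 0# (λ _ → 0#) (λ _ → 0#) ⟩
        0# * 𝔼 (λ _ → 0#) + 0# * 𝔼 (λ _ → 0#)     ≡⟨ solve 1 (λ e → con (pos 0) :* e :+ con (pos 0) :* e := con (pos 0)) refl (𝔼 (λ _ → 0#)) ⟩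
        0# ∎
      𝔼-polynomial ((c , k) ∷ p) (lt ∷ lts) = trans (𝔼-linear c 1# (λ v → v ^ k) (polynomial p))
        (cong₂ (λ x y → c * x + y) (𝔼-^ e₁ e₂ τ-sign -τ-sign k lt) (trans (*-identityˡ _) (𝔼-polynomial p lts)))

    -- Additivity of Frobenius: the mixed terms carry the factor 3.
    cube : ι (pos 3) ≡ 0# → ∀ x y → (x + y) ^ 3 ≡ x ^ 3 + y ^ 3
    cube 3≡0 x y = trans
      (solve 2 (λ x y → (x :+ y) :^ 3 := (x :^ 3 :+ y :^ 3) :+ con (pos 3) :* (x :* x :* y :+ x :* y :* y)) refl x y)
      (trans (cong (λ z → x ^ 3 + y ^ 3 + z * (x * x * y + x * y * y)) 3≡0)
        (solve 2 (λ a b → a :+ con (pos 0) :* b := a) refl _ _))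

    ninth : ι (pos 3) ≡ 0# → ∀ x y → (x + y) ^ 9 ≡ x ^ 9 + y ^ 9
    ninth 3≡0 x y = begin
      (x + y) ^ 9             ≡⟨ ^9 (x + y) ⟩
      ((x + y) ^ 3) ^ 3       ≡⟨ cong (_^ 3) (cube 3≡0 x y) ⟩
      (x ^ 3 + y ^ 3) ^ 3     ≡⟨ cube 3≡0 (x ^ 3) (y ^ 3) ⟩
      (x ^ 3) ^ 3 + (y ^ 3) ^ 3 ≡⟨ sym (cong₂ _+_ (^9 x) (^9 y)) ⟩
      x ^ 9 + y ^ 9 ∎
      where
      ^9 : ∀ x → x ^ 9 ≡ (x ^ 3) ^ 3
      ^9 = solve 1 (λ x → x :^ 9 := (x :^ 3) :^ 3) refl

    α^[m+n] : ∀ m n → α ^ m ≡ 1# → α ^ n ≡ 1# → α ^ (m ℕ.+ n) ≡ 1#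
    α^[m+n] m n α^m α^n = trans (^-homo-* α m n) (trans (cong₂ _*_ α^m α^n) (*-identityˡ 1#))

    α¹≡1⇒α≡1 : α ^ 1 ≡ 1# → α ≡ 1#
    α¹≡1⇒α≡1 = trans (sym (*-identityʳ α))

    -- The sign s is that of τ in the application.
    module AntisymmetricSigns (e₁ e₂ c s : ℤ) (s≢0 : ι s ≢ 0#)
        (τ-sign : [ square? τ ] + [ square? τ ] ≡ ι e₁ + 1#)
        (-τ-sign : [ square? (- τ) ] + [ square? (- τ) ] ≡ ι e₂ + 1#)
        (m₀ : MomentDefs.moment e₁ e₂ 0 ≡ pos 1)
        (c₁ : MomentDefs.shifted e₁ e₂ c 1 0 ≡ pos 0)
        (c₂ : MomentDefs.shifted e₁ e₂ c 2 0 ≡ neg (pos 14))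
        (c₃ : MomentDefs.shifted e₁ e₂ c 3 0 ≡ s ℤ.* pos 120)
        (c₅ : MomentDefs.shifted e₁ e₂ c 5 0 ≡ s ℤ.* pos 5320)
        (c₇ : MomentDefs.shifted e₁ e₂ c 7 0 ≡ s ℤ.* pos 206416)
        (c₈ : MomentDefs.shifted e₁ e₂ c 8 0 ≡ neg (pos 1267898))
        (9<q : 9 ℕ.< q) where

      open MomentDefs e₁ e₂
      open Centred e₁ e₂ τ-sign -τ-sign c c₁ (λ eq → FieldOn.0≢1 F (sym (trans (sym (cong ι m₀)) eq)))
        (ℕₚ.≤-trans (from-yes (3 ℕₚ.≤? 10)) 9<q)

      private
        power : ∀ j k → shifted c j 0 ≡ k → j ℕ.≤ 8 → ι k ≢ 0# → α ^ j ≡ 1#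
        power j k eq j≤8 k≢0 = α^j≡1 j (ℕₚ.≤-trans (ℕ.s≤s (ℕ.s≤s j≤8)) 9<q) (λ z → k≢0 (trans (sym (cong ι eq)) z))

        power₃ : ι (pos 120) ≢ 0# → α ^ 3 ≡ 1#
        power₃ ≢0 = power 3 _ c₃ (from-yes (3 ℕₚ.≤? 8)) (ι-≢0-* s _ s≢0 ≢0)
        power₅ : ι (pos 5320) ≢ 0# → α ^ 5 ≡ 1#
        power₅ ≢0 = power 5 _ c₅ (from-yes (5 ℕₚ.≤? 8)) (ι-≢0-* s _ s≢0 ≢0)
        power₇ : ι (pos 206416) ≢ 0# → α ^ 7 ≡ 1#
        power₇ ≢0 = power 7 _ c₇ (from-yes (7 ℕₚ.≤? 8)) (ι-≢0-* s _ s≢0 ≢0)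

        α¹≡1 : Dec (ι (pos 7) ≡ 0#) → Dec (ι (pos 3) ≡ 0#) → Dec (ι (pos 5) ≡ 0#) → α ^ 1 ≡ 1#
        -- The second central moment -14 vanishes exactly in characteristic 7. There the exponents 3
        -- and 8 survive, and Euclid's algorithm takes them to 1.
        α¹≡1 (yes 7≡0) _ _ = α^[m+n]≡1 2 1 α² α³
          where
          α³ : α ^ 3 ≡ 1#
          α³ = power₃ (ι-coprime (pos 7) (pos 120) (pos 1) (neg (pos 17)) 7≡0 refl)
          α² : α ^ 2 ≡ 1#
          α² = α^[m+n]≡1 3 2 α³ (α^[m+n]≡1 3 5 α³ (power 8 _ c₈ ℕₚ.≤-refl
            (ι-≢0-neg (pos 1267898) (ι-coprime (pos 7) (pos 1267898) (pos 4) (neg (pos 724513)) 7≡0 refl))))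
        α¹≡1 (no 7≢0) 3? 5? = odd-power 3? 5?
          where
          α² : α ^ 2 ≡ 1#
          α² = power 2 _ c₂ (from-yes (2 ℕₚ.≤? 8)) (ι-≢0-neg (pos 14) (ι-≢0-* (pos 2) (pos 7) 2≢0 7≢0))
          odd-power : Dec (ι (pos 3) ≡ 0#) → Dec (ι (pos 5) ≡ 0#) → α ^ 1 ≡ 1#
          -- With α² = 1 any odd exponent suffices. 120 = 8·3·5 fails in characteristics 3 and 5;
          -- 5320 = 8·5·7·19 serves in 3 but not in 5, where 206416 = 16·7·19·97 does.
          odd-power (yes 3≡0) _ = α^[m+n]≡1 2 1 α² (α^[m+n]≡1 2 3 α²
            (power₅ (ι-coprime (pos 3) (pos 5320) (pos 1) (neg (pos 1773)) 3≡0 refl)))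
          odd-power (no _) (yes 5≡0) = α^[m+n]≡1 2 1 α² (α^[m+n]≡1 2 3 α² (α^[m+n]≡1 2 5 α²
            (power₇ (ι-coprime (pos 5) (pos 206416) (pos 1) (neg (pos 41283)) 5≡0 refl))))
          odd-power (no 3≢0) (no 5≢0) = α^[m+n]≡1 2 1 α² (power₃
            (ι-≢0-* (pos 8) (pos 15) (ι-≢0-* (pos 2) (pos 4) 2≢0 4≢0) (ι-≢0-* (pos 3) (pos 5) 3≢0 5≢0)))

      α≡1 : α ≡ 1#
      α≡1 = α¹≡1⇒α≡1 (α¹≡1 (ι (pos 7) ≟ 0#) (ι (pos 3) ≟ 0#) (ι (pos 5) ≟ 0#))

      β≡0 : β ≡ 0#
      β≡0 = trans (solve 2 (λ b c → b := (b :+ c) :+ :- (con (pos 1) :* c)) refl β (ι c))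
                  (trans (cong (λ a → β + ι c + - (a * ι c)) (sym α≡1)) β-centred)

    trivial-if-signs-differ : 9 ℕ.< q → (NonSquare (- τ) × Square τ) ⊎ (Square (- τ) × NonSquare τ) → α ≡ 1# × β ≡ 0#
    trivial-if-signs-differ 9<q (inj₁ (¬-τ , τ□)) = α≡1 , β≡0
      where
      -- The doubled moments of order 0 and 1 are 1 and 4, so the barycentre is 4 and c = -4.
      open AntisymmetricSigns (pos 1) (neg (pos 1)) (neg (pos 4)) (pos 1) (λ eq → FieldOn.0≢1 F (sym eq))
        (cong (λ x → x + x) ([]-true (square? τ) τ□))
        (trans (cong (λ x → x + x) ([]-false (square? (- τ)) ¬-τ)) (solve 0 (con (pos 0) :+ con (pos 0) := :- con (pos 1) :+ con (pos 1)) refl))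
        refl refl refl refl refl refl refl 9<q
    trivial-if-signs-differ 9<q (inj₂ (-τ□ , ¬τ)) = α≡1 , β≡0
      where
      -- Exchanging the signs multiplies the j-th moment by (-1)^j, so the barycentre and the odd
      -- central moments change sign.
      open AntisymmetricSigns (neg (pos 1)) (pos 1) (pos 4) (neg (pos 1)) (ι-≢0-neg (pos 1) (λ eq → FieldOn.0≢1 F (sym eq)))
        (trans (cong (λ x → x + x) ([]-false (square? τ) ¬τ)) (solve 0 (con (pos 0) :+ con (pos 0) := :- con (pos 1) :+ con (pos 1)) refl))
        (cong (λ x → x + x) ([]-true (square? (- τ)) -τ□))
        refl refl refl refl refl refl refl 9<q

    -- With equal signs the odd moments vanish, so the barycentre, if there is one, is 0 and the
    -- shift c is 0.
    module SymmetricSigns (e : ℤ)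
        (τ-sign : [ square? τ ] + [ square? τ ] ≡ ι e + 1#)
        (-τ-sign : [ square? (- τ) ] + [ square? (- τ) ] ≡ ι e + 1#) (12<q : 12 ℕ.< q) where
      open MomentDefs e e

      private
        below : ∀ {j} → j ℕ.≤ 11 → suc j ℕ.< q
        below j≤11 = ℕₚ.≤-trans (ℕ.s≤s (ℕ.s≤s j≤11)) 12<q

      module Central (c₁ : shifted (pos 0) 1 0 ≡ pos 0) (m₀≢0 : ι (moment 0) ≢ 0#) where
        open Centred e e τ-sign -τ-sign (pos 0) c₁ m₀≢0 (below (from-yes (1 ℕₚ.≤? 11)))

        β≡0 : β ≡ 0#
        β≡0 = trans (solve 2 (λ a b → b := (b :+ con (pos 0)) :+ :- (a :* con (pos 0))) refl α β) β-centred

        power : ∀ j k → shifted (pos 0) j 0 ≡ k → j ℕ.≤ 11 → ι k ≢ 0# → α ^ j ≡ 1#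
        power j k eq j≤11 k≢0 = α^j≡1 j (below j≤11) (λ z → k≢0 (trans (sym (cong ι eq)) z))

      𝔼-power : ∀ j k → moment j ≡ k → j ℕ.≤ 11 → 𝔼 (λ v → v ^ j) ≡ ι k
      𝔼-power j k eq j≤11 = trans (𝔼-^ e e τ-sign -τ-sign j (below j≤11)) (cong ι eq)

    -- In the coordinate v the reflection x ↦ τ - x is v ↦ -v.
    Half-turn : Set
    Half-turn = (α ≡ 1# ⊎ α ≡ - 1#) × β ≡ 0#

    module NonSquareSigns (12<q : 12 ℕ.< q) (¬τ : NonSquare τ) (¬-τ : NonSquare (- τ)) where
      private
        sign : ∀ {x} → NonSquare x → [ square? x ] + [ square? x ] ≡ ι (neg (pos 1)) + 1#
        sign {x} ¬s = trans (cong (λ x → x + x) ([]-false (square? x) ¬s)) (solve 0 (con (pos 0) :+ con (pos 0) := :- con (pos 1) :+ con (pos 1)) refl)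
      open SymmetricSigns (neg (pos 1)) (sign ¬τ) (sign ¬-τ) 12<q
      open Central refl (ι-≢0-neg (pos 1) (λ eq → FieldOn.0≢1 F (sym eq)))

      private
        α²≡1 : Dec (ι (pos 3) ≡ 0#) → α ^ 2 ≡ 1#
        α²≡1 (no 3≢0) = power 2 (neg (pos 6)) refl (from-yes (2 ℕₚ.≤? 11))
          (ι-≢0-neg (pos 6) (ι-≢0-* (pos 2) (pos 3) 2≢0 3≢0))
        -- In characteristic 3 the moments -6 and -108 of orders 2 and 6 vanish. Orders 4 and 8
        -- alone would give only α⁴ = 1; orders 4 and 10 have greatest common divisor 2.
        α²≡1 (yes 3≡0) = α^[m+n]≡1 4 2 α⁴ (α^[m+n]≡1 4 6 α⁴ (power 10 (neg (pos 1796)) refl (from-yes (10 ℕₚ.≤? 11))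
            (ι-≢0-neg (pos 1796) (ι-coprime (pos 3) (pos 1796) (pos 2) (neg (pos 1197)) 3≡0 refl))))
          where
          α⁴ : α ^ 4 ≡ 1#
          α⁴ = power 4 (neg (pos 26)) refl (from-yes (4 ℕₚ.≤? 11))
            (ι-≢0-neg (pos 26) (ι-coprime (pos 3) (pos 26) (pos 2) (neg (pos 17)) 3≡0 refl))

      half-turn : Half-turn
      half-turn = α²≡1⇒α≡±1 (α²≡1 (ι (pos 3) ≟ 0#)) , β≡0

    module SquareSigns (12<q : 12 ℕ.< q) (τ□ : Square τ) (-τ□ : Square (- τ)) where
      private
        sign : ∀ {x} → Square x → [ square? x ] + [ square? x ] ≡ ι (pos 1) + 1#
        sign {x} s = cong (λ x → x + x) ([]-true (square? x) s)
      open SymmetricSigns (pos 1) (sign τ□) (sign -τ□) 12<q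
      open MomentDefs (pos 1) (pos 1)

      private
        half-turn-generic : ι (pos 3) ≢ 0# → Half-turn
        half-turn-generic 3≢0 = α²≡1⇒α≡±1 (α²≡1 (ι (pos 5) ≟ 0#)) , β≡0
          where
          open Central refl 3≢0
          α²≡1 : Dec (ι (pos 5) ≡ 0#) → α ^ 2 ≡ 1#
          α²≡1 (no 5≢0) = power 2 (pos 10) refl (from-yes (2 ℕₚ.≤? 11)) (ι-≢0-* (pos 2) (pos 5) 2≢0 5≢0)
          -- The second moment 10 vanishes in characteristic 5; the moments 38 and 148 of orders 4
          -- and 6 do not.
          α²≡1 (yes 5≡0) = α^[m+n]≡1 4 2
            (power 4 (pos 38) refl (from-yes (4 ℕₚ.≤? 11)) (ι-coprime (pos 5) (pos 38) (pos 2) (neg (pos 15)) 5≡0 refl))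
            (power 6 (pos 148) refl (from-yes (6 ℕₚ.≤? 11)) (ι-coprime (pos 5) (pos 148) (pos 2) (neg (pos 59)) 5≡0 refl))

        -- In characteristic 3 the base block has no barycentre.
        module Char3 (3≡0 : ι (pos 3) ≡ 0#) where
          mod3 : ∀ {j n} r k → n ≡ r ℤ.+ k ℤ.* pos 3 → moment j ≡ n → ι (moment j) ≡ ι r
          mod3 r k eq m = trans (cong ι m) (ι-mod (pos 3) _ r k 3≡0 eq)

          m₀ : ι (moment 0) ≡ 0#
          m₀ = 3≡0
          m₂ : ι (moment 2) ≡ 1#
          m₂ = mod3 {2} {pos 10} (pos 1) (pos 3) refl refl

          -- As the moments of order 0 and 1 vanish, the second moment is insensitive to translation
          -- and scales by α² under the map.
          α²≡1 : α ^ 2 ≡ 1#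
          α²≡1 = begin
            α ^ 2
              ≡⟨ solve 3 (λ x y z → x := x :* con (pos 1) :+ (y :* con (pos 0) :+ (z :* con (pos 0) :+ con (pos 0)))) refl (α ^ 2) (ι (pos 2) * (α * β)) (β ^ 2) ⟩
            α ^ 2 * 1# + (ι (pos 2) * (α * β) * 0# + (β ^ 2 * 0# + 0#))
              ≡⟨ cong₂ (λ x y → α ^ 2 * x + (ι (pos 2) * (α * β) * 0# + (β ^ 2 * y + 0#))) (sym m₂) (sym m₀) ⟩
            expectation (pos 1) (pos 1) (sign τ□) (sign -τ□) p
              ≡⟨ sym (𝔼-polynomial (pos 1) (pos 1) (sign τ□) (sign -τ□) p (below₂ ∷ below₁ ∷ below₀ ∷ [])) ⟩
            𝔼 (polynomial (pos 1) (pos 1) (sign τ□) (sign -τ□) p)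
              ≡⟨ 𝔼-cong (λ v → solve 3 (λ a b v →
                   a :^ 2 :* v :^ 2 :+ con (pos 1) :* (con (pos 2) :* (a :* b) :* v :^ 1 :+ con (pos 1) :* (b :^ 2 :* v :^ 0 :+ con (pos 1) :* con (pos 0)))
                   := (a :* v :+ b) :^ 2) refl α β v) ⟩
            𝔼 (λ v → (α * v + β) ^ 2)
              ≡⟨ 𝔼-invariant (λ v → v ^ 2) ⟩
            𝔼 (λ v → v ^ 2)
              ≡⟨ 𝔼-power 2 (moment 2) refl (from-yes (2 ℕₚ.≤? 11)) ⟩
            ι (moment 2)
              ≡⟨ m₂ ⟩
            1# ∎
            where
            p : List (Fin q × ℕ)
            p = (α ^ 2 , 2) ∷ (ι (pos 2) * (α * β) , 1) ∷ (β ^ 2 , 0) ∷ []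
            below₂ : 3 ℕ.< q
            below₂ = ℕₚ.≤-trans (from-yes (4 ℕₚ.≤? 13)) 12<q
            below₁ : 2 ℕ.< q
            below₁ = ℕₚ.≤-trans (from-yes (3 ℕₚ.≤? 13)) 12<q
            below₀ : 1 ℕ.< q
            below₀ = ℕₚ.≤-trans (from-yes (2 ℕₚ.≤? 13)) 12<q

          -- Expand (αv + β)^(n+2) for a power n of 3.
          β+β^n≡0 : ∀ n → (∀ x y → (x + y) ^ n ≡ x ^ n + y ^ n) → n ℕ.≤ 9 → α ^ suc n ≡ 1# →
            ι (moment n) ≡ 0# → ι (moment (suc n)) ≡ ι (pos 2) → ι (moment (suc (suc n))) ≡ 0# →
            β + β ^ n ≡ 0#
          β+β^n≡0 n additive n≤9 α^[1+n]≡1 mₙ mₙ₊₁ mₙ₊₂ = begin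
            β + B
              -- Two terms of the expansion survive: 2α^(n+1)β times the moment 2 of order n + 1,
              -- and α²β^n times the moment 1 of order 2. Their sum is 4β + β^n, and 4 = 1 in
              -- characteristic 3.
              ≡⟨ solve 2 (λ b c → b :+ c := con (pos 2) :* con (pos 1) :* b :* con (pos 2) :+ c :* con (pos 1) :+ :- (con (pos 3) :* b)) refl β B ⟩
            ι (pos 2) * 1# * β * ι (pos 2) + B * 1# + - (ι (pos 3) * β)
              ≡⟨ cong₂ (λ x y → ι (pos 2) * x * β * ι (pos 2) + B * y + - (ι (pos 3) * β)) (sym α^[1+n]≡1) (sym α²≡1) ⟩
            ι (pos 2) * (α * A) * β * ι (pos 2) + B * α ^ 2 + - (ι (pos 3) * β)
              ≡⟨ cong (λ x → ι (pos 2) * (α * A) * β * ι (pos 2) + B * α ^ 2 + - (x * β)) 3≡0 ⟩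
            ι (pos 2) * (α * A) * β * ι (pos 2) + B * α ^ 2 + - (0# * β)
              ≡⟨ solve 4 (λ a b A B → con (pos 2) :* (a :* A) :* b :* con (pos 2) :+ B :* a :^ 2 :+ :- (con (pos 0) :* b) :=
                   (a :^ 2 :* A) :* con (pos 0) :+ ((con (pos 2) :* (a :* A) :* b) :* con (pos 2) :+ ((A :* b :^ 2) :* con (pos 0)
                   :+ ((B :* a :^ 2) :* con (pos 1) :+ ((con (pos 2) :* (B :* a) :* b) :* con (pos 0) :+ ((B :* b :^ 2) :* con (pos 0) :+ con (pos 0))))))) refl α β A B ⟩
            α ^ 2 * A * 0# + (ι (pos 2) * (α * A) * β * ι (pos 2) + (A * β ^ 2 * 0# + (B * α ^ 2 * 1# + (ι (pos 2) * (B * α) * β * 0# + (B * β ^ 2 * 0# + 0#)))))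
              ≡⟨ cong₂ _+_ (cong (α ^ 2 * A *_) (sym mₙ₊₂)) (cong₂ _+_ (cong (ι (pos 2) * (α * A) * β *_) (sym mₙ₊₁))
                   (cong₂ _+_ (cong (A * β ^ 2 *_) (sym mₙ)) (cong₂ (λ x y → B * α ^ 2 * x + (ι (pos 2) * (B * α) * β * 0# + (B * β ^ 2 * y + 0#))) (sym m₂) (sym m₀)))) ⟩
            expectation (pos 1) (pos 1) (sign τ□) (sign -τ□) p
              ≡⟨ sym (𝔼-polynomial (pos 1) (pos 1) (sign τ□) (sign -τ□) p
                   (below (ℕ.s≤s (ℕ.s≤s n≤9)) ∷ below (ℕ.s≤s (ℕₚ.m≤n⇒m≤1+n n≤9)) ∷ below (ℕₚ.m≤n⇒m≤1+n (ℕₚ.m≤n⇒m≤1+n n≤9))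
                    ∷ below (from-yes (2 ℕₚ.≤? 11)) ∷ below (from-yes (1 ℕₚ.≤? 11)) ∷ below ℕ.z≤n ∷ [])) ⟩
            𝔼 (polynomial (pos 1) (pos 1) (sign τ□) (sign -τ□) p)
              ≡⟨ 𝔼-cong expand ⟩
            𝔼 (λ v → (α * v + β) ^ suc (suc n))
              ≡⟨ 𝔼-invariant (λ v → v ^ suc (suc n)) ⟩
            𝔼 (λ v → v ^ suc (suc n))
              ≡⟨ 𝔼-power (suc (suc n)) _ refl (ℕ.s≤s (ℕ.s≤s n≤9)) ⟩
            ι (moment (suc (suc n)))
              ≡⟨ mₙ₊₂ ⟩
            0# ∎
            where
            below : ∀ {j} → j ℕ.≤ 11 → suc j ℕ.< q
            below j≤11 = ℕₚ.≤-trans (ℕ.s≤s (ℕ.s≤s j≤11)) 12<q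
            A B : Fin q
            A = α ^ n
            B = β ^ n
            p : List (Fin q × ℕ)
            p = (α ^ 2 * A , suc (suc n)) ∷ (ι (pos 2) * (α * A) * β , suc n) ∷ (A * β ^ 2 , n)
              ∷ (B * α ^ 2 , 2) ∷ (ι (pos 2) * (B * α) * β , 1) ∷ (B * β ^ 2 , 0) ∷ []
            expand : ∀ v → polynomial (pos 1) (pos 1) (sign τ□) (sign -τ□) p v ≡ (α * v + β) ^ suc (suc n)
            expand v = trans
              (solve 6 (λ a b A B v V →
                 (a :^ 2 :* A) :* (v :* (v :* V)) :+ con (pos 1) :* ((con (pos 2) :* (a :* A) :* b) :* (v :* V) :+ con (pos 1) :* ((A :* b :^ 2) :* V
                 :+ con (pos 1) :* ((B :* a :^ 2) :* v :^ 2 :+ con (pos 1) :* ((con (pos 2) :* (B :* a) :* b) :* v :^ 1 :+ con (pos 1) :* ((B :* b :^ 2) :* v :^ 0 :+ con (pos 1) :* con (pos 0))))))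
                 := (a :* v :+ b) :* ((a :* v :+ b) :* (A :* V :+ B))) refl α β A B v (v ^ n))
              (cong (λ z → (α * v + β) * ((α * v + β) * z))
                (sym (trans (additive (α * v) β) (cong (_+ B) (^-distrib-* α v n)))))

          α⁴≡1 : α ^ 4 ≡ 1#
          α⁴≡1 = α^[m+n] 2 2 α²≡1 α²≡1

          β+β³≡0 : β + β ^ 3 ≡ 0#
          β+β³≡0 = β+β^n≡0 3 (cube 3≡0) (from-yes (3 ℕₚ.≤? 9)) α⁴≡1
            refl (mod3 {4} {pos 38} (pos 2) (pos 12) refl refl) refl

          -- A second relation is required: τ and -τ are squares, so -1 is one too, and β + β³ = 0
          -- alone would allow its square roots.
          β+β⁹≡0 : β + β ^ 9 ≡ 0#
          β+β⁹≡0 = β+β^n≡0 9 (ninth 3≡0) (from-yes (9 ℕₚ.≤? 9)) (α^[m+n] 4 6 α⁴≡1 (α^[m+n] 2 4 α²≡1 α⁴≡1))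
            refl (mod3 {10} {pos 2300} (pos 2) (pos 766) refl refl) refl

          -- If β ≠ 0 then β² = -1, so that β⁸ = 1, whereas β⁸ = -1.
          β≡0 : β ≡ 0#
          β≡0 with β ≟ 0#
          ... | yes eq = eq
          ... | no β≢0 = contradiction 2β≡0 (*-nonzero 2≢0 β≢0)
            where
            1+β²≡0 : 1# + β ^ 2 ≡ 0#
            1+β²≡0 = *-cancel β≢0 (trans (solve 1 (λ b → b :* (con (pos 1) :+ b :^ 2) := b :+ b :^ 3) refl β) (trans β+β³≡0 (sym (zeroʳ β))))
            2β≡0 : ι (pos 2) * β ≡ 0#
            2β≡0 = begin
              ι (pos 2) * β
                ≡⟨ solve 1 (λ b → con (pos 2) :* b := (b :+ b :^ 9) :+ (con (pos 1) :+ b :^ 2) :* (b :* (con (pos 1) :+ :- (b :^ 2)) :* (con (pos 1) :+ b :^ 4))) refl β ⟩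
              (β + β ^ 9) + (1# + β ^ 2) * (β * (1# + - (β ^ 2)) * (1# + β ^ 4))
                ≡⟨ cong₂ (λ x y → x + y * (β * (1# + - (β ^ 2)) * (1# + β ^ 4))) β+β⁹≡0 1+β²≡0 ⟩
              0# + 0# * (β * (1# + - (β ^ 2)) * (1# + β ^ 4))
                ≡⟨ trans (+-identityˡ _) (zeroˡ _) ⟩
              0# ∎

      half-turn : Half-turn
      half-turn with ι (pos 3) ≟ 0#
      ... | no 3≢0 = half-turn-generic 3≢0
      ... | yes 3≡0 = α²≡1⇒α≡±1 (Char3.α²≡1 3≡0) , Char3.β≡0 3≡0

-- Counting with lists and subsets

module _ where
  open Count

  unique-map : ∀ {A B : Set} (f : A → B) {xs : List A} → Unique xs →
               (∀ {x y} → x LM.∈ xs → y LM.∈ xs → f x ≡ f y → x ≡ y) → Unique (List.map f xs)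
  unique-map f [] inj = []
  unique-map f (x∉ ∷ u) inj =
    Allₚ.map⁺ (All.tabulate (λ y∈ fx≡fy → All.lookup x∉ y∈ (inj (here refl) (there y∈) fx≡fy)))
    ∷ unique-map f u (λ x∈ y∈ → inj (there x∈) (there y∈))

  length-filter-map-filter : ∀ {A B : Set} {P : B → Set} {G : A → Set}
    (P? : Decidable P) (G? : Decidable G) (f : A → B) (xs : List A) →
    length (filter P? (List.map f (filter G? xs))) ≡ sumᴸ (List.map (λ x → [ G? x ] ℕ.* [ P? (f x) ]) xs)
  length-filter-map-filter P? G? f [] = refl
  length-filter-map-filter P? G? f (x ∷ xs) with G? x
  ... | no _ = length-filter-map-filter P? G? f xs
  ... | yes _ with P? (f x)
  ...   | yes _ = cong suc (length-filter-map-filter P? G? f xs)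
  ...   | no _ = length-filter-map-filter P? G? f xs

  sum-cartesianProduct : ∀ {A B : Set} (w : A × B → ℕ) (xs : List A) (ys : List B) →
    sumᴸ (List.map w (cartesianProduct xs ys)) ≡ sumᴸ (List.map (λ x → sumᴸ (List.map (λ y → w (x , y)) ys)) xs)
  sum-cartesianProduct w [] ys = refl
  sum-cartesianProduct w (x ∷ xs) ys = begin
    sumᴸ (List.map w (List.map (x ,_) ys List.++ cartesianProduct xs ys))
      ≡⟨ cong sumᴸ (map-++ w (List.map (x ,_) ys) _) ⟩
    sumᴸ (List.map w (List.map (x ,_) ys) List.++ List.map w (cartesianProduct xs ys))
      ≡⟨ sum-++ (List.map w (List.map (x ,_) ys)) _ ⟩
    sumᴸ (List.map w (List.map (x ,_) ys)) ℕ.+ sumᴸ (List.map w (cartesianProduct xs ys))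
      ≡⟨ cong₂ ℕ._+_ (cong sumᴸ (sym (map-∘ ys))) (sum-cartesianProduct w xs ys) ⟩
    sumᴸ (List.map (λ y → w (x , y)) ys) ℕ.+ sumᴸ (List.map (λ x → sumᴸ (List.map (λ y → w (x , y)) ys)) xs) ∎
    where open ≡-Reasoning

  sum-allFin : ∀ {n} (w : Fin n → ℕ) → sumᴸ (List.map w (allFin n)) ≡ sum w
  sum-allFin w = trans (cong sumᴸ (map-tabulate (λ x → x) w)) (sum-tabulate w)
    where
    sum-tabulate : ∀ {n} (w : Fin n → ℕ) → sumᴸ (List.tabulate w) ≡ sum w
    sum-tabulate {zero} w = refl
    sum-tabulate {suc n} w = cong (w zero ℕ.+_) (sum-tabulate (w ∘ suc))

  module _ {n} {P : Fin n → Set} (P? : Decidable P) where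
    ⟪_⟫ : Subset n
    ⟪_⟫ = tabulate (λ x → does (P? x))

    ∈⟪⟫⁺ : ∀ {x} → P x → x ∈ ⟪_⟫
    ∈⟪⟫⁺ {x} p = lookup⇒[]= x _ (trans (lookup∘tabulate _ x) (dec-true (P? x) p))

    ∈⟪⟫⁻ : ∀ {x} → x ∈ ⟪_⟫ → P x
    ∈⟪⟫⁻ {x} x∈ with P? x | trans (sym (lookup∘tabulate (λ x → does (P? x)) x)) ([]=⇒lookup x∈)
    ... | yes p | _ = p

  ∣tabulate∣ : ∀ {n} (f : Fin n → Bool) → ∣ tabulate f ∣ ≡ sum (λ x → if f x then 1 else 0)
  ∣tabulate∣ {zero} f = refl
  ∣tabulate∣ {suc n} f with f zero
  ... | true = cong suc (∣tabulate∣ (f ∘ suc))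
  ... | false = ∣tabulate∣ (f ∘ suc)

  ∣p∣≡0⇒∉ : ∀ {n} (p : Subset n) → ∣ p ∣ ≡ 0 → ∀ {x} → ¬ x ∈ p
  ∣p∣≡0⇒∉ (outside ∷ p) eq (there x∈) = ∣p∣≡0⇒∉ p eq x∈

  ∣p∣≡1⇒singleton : ∀ {n} (p : Subset n) → ∣ p ∣ ≡ 1 → ∃ λ u → u ∈ p × (∀ {x} → x ∈ p → x ≡ u)
  ∣p∣≡1⇒singleton (inside ∷ p) eq = zero , here ,
    λ { here → refl ; (there x∈) → contradiction x∈ (∣p∣≡0⇒∉ p (ℕₚ.suc-injective eq)) }
  ∣p∣≡1⇒singleton (outside ∷ p) eq with ∣p∣≡1⇒singleton p eq
  ... | u , u∈ , only = suc u , there u∈ , λ { (there x∈) → cong suc (only x∈) }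

  ∣p∣≡2⇒pair : ∀ {n} (p : Subset n) → ∣ p ∣ ≡ 2 →
    ∃ λ u → ∃ λ v → u ≢ v × u ∈ p × v ∈ p × (∀ {x} → x ∈ p → x ≡ u ⊎ x ≡ v)
  ∣p∣≡2⇒pair (inside ∷ p) eq with ∣p∣≡1⇒singleton p (ℕₚ.suc-injective eq)
  ... | v , v∈ , only = zero , suc v , (λ ()) , here , there v∈ ,
    λ { here → inj₁ refl ; (there x∈) → inj₂ (cong suc (only x∈)) }
  ∣p∣≡2⇒pair (outside ∷ p) eq with ∣p∣≡2⇒pair p eq
  ... | u , v , u≢v , u∈ , v∈ , only = suc u , suc v , u≢v ∘ suc-injective , there u∈ , there v∈ ,
    λ { (there x∈) → [ inj₁ ∘ cong suc , inj₂ ∘ cong suc ]′ (only x∈) }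

  [×]≡* : ∀ {P Q : Set} (p : Dec P) (q : Dec Q) → [ p ×-dec q ] ≡ [ p ] ℕ.* [ q ]
  [×]≡* (yes _) (yes _) = refl
  [×]≡* (yes _) (no _) = refl
  [×]≡* (no _) _ = refl

-- Blocks and the pairs they contain

module Design {q : ℕ} (F : FieldOn q) (odd : ∀ m → q ≢ m ℕ.+ m) (τ : Fin q) (τ≢0 : τ ≢ FieldOn.0F F) where
  open Base F odd τ τ≢0
  open Count
  open ≡-Reasoning

  cancel-inv : ∀ {a} → a ≢ 0# → ∀ x → a * (inv a * x) ≡ x
  cancel-inv {a} a≢0 x = trans (solve 3 (λ a i x → a :* (i :* x) := (a :* i) :* x) refl a (inv a) x)
    (trans (cong (_* x) (*-inv a≢0)) (*-identityˡ x))

  cancel-inv′ : ∀ {a} → a ≢ 0# → ∀ x → inv a * (a * x) ≡ x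
  cancel-inv′ {a} a≢0 x = trans (solve 3 (λ a i x → i :* (a :* x) := a :* (i :* x)) refl a (inv a) x) (cancel-inv a≢0 x)

  -- Blocks are parametrised by the inverses x ↦ cx + d of the affine maps.
  block : Fin q → Fin q → Subset q
  block c d = ⟪ (λ x → inBase? (c * x + d)) ⟫

  ∈block⁺ : ∀ c d {x} → InBase (c * x + d) → x ∈ block c d
  ∈block⁺ c d = ∈⟪⟫⁺ (λ x → inBase? (c * x + d))

  ∈block⁻ : ∀ c d {x} → x ∈ block c d → InBase (c * x + d)
  ∈block⁻ c d = ∈⟪⟫⁻ (λ x → inBase? (c * x + d))

  isBlock⇒block : ∀ {S} → IsBlock F τ S → ∃ λ c → ∃ λ d → c ≢ 0# × S ≡ block c d
  isBlock⇒block {S} (a , b , a≢0 , char) = c , d , inv-nonzero a≢0 ,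
      ⊆-antisym (λ x∈ → ∈block⁺ c d (⊆₁ x∈)) (λ {x} x∈ → Equivalence.from (char x) (c * x + d , ∈block⁻ c d x∈ , image x))
    where
    c d : Fin q
    c = inv a
    d = - (inv a * b)
    image : ∀ x → x ≡ a * (c * x + d) + b
    image x = sym (trans (solve 4 (λ a i x b → a :* (i :* x :+ :- (i :* b)) :+ b := a :* (i :* (x :+ :- b)) :+ b) refl a (inv a) x b)
      (trans (cong (_+ b) (cancel-inv a≢0 (x + - b))) (solve 2 (λ x b → (x :+ :- b) :+ b := x) refl x b)))
    ⊆₁ : ∀ {x} → x ∈ S → InBase (c * x + d)
    ⊆₁ {x} x∈ with Equivalence.to (char x) x∈
    ... | y , y∈ , refl = subst InBase (sym (trans
      (solve 4 (λ a i y b → i :* (a :* y :+ b) :+ :- (i :* b) := i :* (a :* y)) refl a (inv a) y b) (cancel-inv′ a≢0 y))) y∈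

  block-isBlock : ∀ c d → c ≢ 0# → IsBlock F τ (block c d)
  block-isBlock c d c≢0 = inv c , - (inv c * d) , inv-nonzero c≢0 , λ x → mk⇔
    (λ x∈ → c * x + d , ∈block⁻ c d x∈ , sym (trans
      (solve 4 (λ c i x d → i :* (c :* x :+ d) :+ :- (i :* d) := i :* (c :* x)) refl c (inv c) x d) (cancel-inv′ c≢0 x)))
    (λ { (y , y∈ , refl) → ∈block⁺ c d (subst InBase (sym (trans
      (solve 4 (λ c i y d → c :* (i :* y :+ :- (i :* d)) :+ d := c :* (i :* (y :+ :- d)) :+ d) refl c (inv c) y d)
      (trans (cong (_+ d) (cancel-inv c≢0 (y + - d))) (solve 2 (λ y d → (y :+ :- d) :+ d := y) refl y d)))) y∈) })

  -- If two blocks agree then x ↦ cx + d and x ↦ c′x + d′ differ by an affine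
  -- map v ↦ αv + β (in the coordinate v) stabilising the base block.
  module Transition {c d c′ d′ : Fin q} (c≢0 : c ≢ 0#) (c′≢0 : c′ ≢ 0#) (same : block c d ≡ block c′ d′) where
    α β : Fin q
    α = c′ * inv c
    -- Solves κ(αv + β + 2) = ακ(v + 2) + (d′ - αd), the map x ↦ αx + (d′ - αd) written in the
    -- coordinate v.
    β = inv κ * (d′ + - (α * d)) + ι (pos 2) * (α + - 1#)

    α≢0 : α ≢ 0#
    α≢0 = *-nonzero c′≢0 (inv-nonzero c≢0)

    private
      pre : Fin q → Fin q
      pre v = inv c * (point v + - d)

      point≡ : ∀ v → c * pre v + d ≡ point v
      point≡ v = trans (cong (_+ d) (cancel-inv c≢0 (point v + - d))) (solve 2 (λ p d → (p :+ :- d) :+ d := p) refl (point v) d)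

      point′≡ : ∀ v → c′ * pre v + d′ ≡ point (α * v + β)
      point′≡ v = sym (begin
        κ * ((α * v + (inv κ * (d′ + - (α * d)) + 2# * (α + - 1#))) + 2#)
          ≡⟨ solve 6 (λ k i a v d d′ → k :* ((a :* v :+ (i :* (d′ :+ :- (a :* d)) :+ con (pos 2) :* (a :+ :- con (pos 1)))) :+ con (pos 2))
               := k :* (a :* (v :+ con (pos 2))) :+ k :* (i :* (d′ :+ :- (a :* d)))) refl κ (inv κ) α v d d′ ⟩
        κ * (α * (v + 2#)) + κ * (inv κ * (d′ + - (α * d)))
          ≡⟨ cong (κ * (α * (v + 2#)) +_) (cancel-inv κ≢0 _) ⟩
        κ * (α * (v + 2#)) + (d′ + - (α * d))
          ≡⟨ solve 6 (λ k c′ i v d d′ → k :* ((c′ :* i) :* (v :+ con (pos 2))) :+ (d′ :+ :- ((c′ :* i) :* d))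
               := c′ :* (i :* (k :* (v :+ con (pos 2)) :+ :- d)) :+ d′) refl κ c′ (inv c) v d d′ ⟩
        c′ * pre v + d′ ∎)

    stable : ∀ v → InBase (point v) → InBase (point (α * v + β))
    stable v p = subst InBase (point′≡ v) (∈block⁻ c′ d′ (subst (pre v ∈_) same (∈block⁺ c d (subst InBase (sym (point≡ v)) p))))

    stable⁻¹ : ∀ v → InBase (point (α * v + β)) → InBase (point v)
    stable⁻¹ v p = subst InBase (point≡ v) (∈block⁻ c d (subst (pre v ∈_) (sym same) (∈block⁺ c′ d′ (subst InBase (sym (point′≡ v)) p))))

    private
      c′≡αc : c′ ≡ α * c
      c′≡αc = sym (trans (solve 3 (λ c′ i c → (c′ :* i) :* c := c :* (i :* c′)) refl c′ (inv c) c) (cancel-inv c≢0 c′))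

      κβ : β ≡ 0# → (d′ + - (α * d)) + κ * (ι (pos 2) * (α + - 1#)) ≡ 0#
      κβ β≡0 = begin
        (d′ + - (α * d)) + κ * (2# * (α + - 1#))
          ≡⟨ cong (_+ κ * (2# * (α + - 1#))) (sym (cancel-inv κ≢0 _)) ⟩
        κ * (inv κ * (d′ + - (α * d))) + κ * (2# * (α + - 1#))
          ≡⟨ solve 3 (λ k x y → k :* x :+ k :* y := k :* (x :+ y)) refl κ (inv κ * (d′ + - (α * d))) (2# * (α + - 1#)) ⟩
        κ * β
          ≡⟨ trans (cong (κ *_) β≡0) (zeroʳ κ) ⟩
        0# ∎

    identity : α ≡ 1# → β ≡ 0# → c ≡ c′ × d ≡ d′
    identity α≡1 β≡0 = sym (trans c′≡αc (trans (cong (_* c) α≡1) (*-identityˡ c))) ,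
      sym (x-y≡0⇒x≡y (trans (solve 3 (λ d d′ k → d′ :+ :- d := (d′ :+ :- (con (pos 1) :* d)) :+ k :* (con (pos 2) :* (con (pos 1) :+ :- con (pos 1)))) refl d d′ κ)
        (trans (cong (λ a → (d′ + - (a * d)) + κ * (2# * (a + - 1#))) (sym α≡1)) (κβ β≡0))))

    opposite : α ≡ - 1# → c′ ≡ - c
    opposite α≡-1 = trans c′≡αc (trans (cong (_* c) α≡-1) (solve 1 (λ c → (:- con (pos 1)) :* c := :- c) refl c))

  k : ℕ
  k = sum (λ x → [ inBase? x ])

  b : Fin q → ℕ
  b x = [ inBase? x ]

  ∣block∣ : ∀ c d → c ≢ 0# → ∣ block c d ∣ ≡ k
  ∣block∣ c d c≢0 = trans (∣tabulate∣ (λ x → does (inBase? (c * x + d))))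
    (sum-reindex (λ x → c * x + d) (λ y → inv c * (y + - d))
      (λ y → trans (cong (_+ d) (cancel-inv c≢0 (y + - d))) (solve 2 (λ y d → (y :+ :- d) :+ d := y) refl y d))
      (λ x → trans (cong (inv c *_) (solve 2 (λ x d → (x :+ d) :+ :- d := x) refl (c * x) d)) (cancel-inv′ c≢0 x)) b)

  nonzero? : ∀ (c : Fin q) → Dec (c ≢ 0#)
  nonzero? c = ¬? (c ≟ 0#)

  -- (c , d) corresponds to the ordered pair (cu + d , cv + d) of distinct points.
  #pairs : ∀ {u v} → u ≢ v →
    sum (λ c → sum (λ d → [ nonzero? c ] ℕ.* (b (c * u + d) ℕ.* b (c * v + d)))) ≡ k ℕ.* (k ℕ.∸ 1)
  #pairs {u} {v} u≢v = begin
    sum (λ c → sum (λ d → [ nonzero? c ] ℕ.* (b (c * u + d) ℕ.* b (c * v + d))))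
      ≡⟨ sum-cong-≗ (λ c → trans
           (sum-cong-≗ (λ d → cong (λ y → [ nonzero? c ] ℕ.* (b (c * u + d) ℕ.* b y))
             (solve 4 (λ c u v d → c :* v :+ d := (c :* u :+ d) :+ c :* (v :+ :- u)) refl c u v d)))
           (sum-reindex (c * u +_) (- (c * u) +_)
             (λ x → solve 2 (λ m x → m :+ (:- m :+ x) := x) refl (c * u) x)
             (λ x → solve 2 (λ m x → :- m :+ (m :+ x) := x) refl (c * u) x)
             (λ x → [ nonzero? c ] ℕ.* (b x ℕ.* b (x + c * w))))) ⟩
    sum (λ c → sum (λ x → [ nonzero? c ] ℕ.* (b x ℕ.* b (x + c * w))))
      ≡⟨ ∑-comm (λ c x → [ nonzero? c ] ℕ.* (b x ℕ.* b (x + c * w))) ⟩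
    sum (λ x → sum (λ c → [ nonzero? c ] ℕ.* (b x ℕ.* b (x + c * w))))
      ≡⟨ sum-cong-≗ (λ x → trans
           (sum-cong-≗ (λ c → cong (ℕ._* (b x ℕ.* b (x + c * w))) ([]-cong (nonzero? c) (¬? (x + c * w ≟ x)) (to x c) (from x c))))
           (sum-reindex (λ c → x + c * w) (λ y → (y + - x) * inv w)
             (λ y → trans (solve 4 (λ x y i w → x :+ ((y :+ :- x) :* i) :* w := x :+ w :* (i :* (y :+ :- x))) refl x y (inv w) w)
               (trans (cong (x +_) (cancel-inv w≢0 _)) (solve 2 (λ x y → x :+ (y :+ :- x) := y) refl x y)))
             (λ c → trans (solve 4 (λ x c i w → ((x :+ c :* w) :+ :- x) :* i := w :* (i :* c)) refl x c (inv w) w) (cancel-inv w≢0 c))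
             (λ y → [ ¬? (y ≟ x) ] ℕ.* (b x ℕ.* b y)))) ⟩
    off-diagonal
      -- Adding the diagonal, which contributes `k`, completes the double sum to k · k; the
      -- truncated subtraction is therefore exact.
      ≡⟨ sym (ℕₚ.m+n∸n≡m off-diagonal k) ⟩
    off-diagonal ℕ.+ k ℕ.∸ k
      ≡⟨ cong (ℕ._∸ k) total ⟩
    k ℕ.* k ℕ.∸ k
      ≡⟨ cong (k ℕ.* k ℕ.∸_) (sym (ℕₚ.*-identityʳ k)) ⟩
    k ℕ.* k ℕ.∸ k ℕ.* 1
      ≡⟨ sym (ℕₚ.*-distribˡ-∸ k k 1) ⟩
    k ℕ.* (k ℕ.∸ 1) ∎
    where
    w : Fin q
    w = v + - u
    w≢0 : w ≢ 0#
    w≢0 eq = u≢v (sym (x-y≡0⇒x≡y eq))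
    to : ∀ x c → c ≢ 0# → x + c * w ≢ x
    to x c c≢0 eq = *-nonzero c≢0 w≢0 (trans (solve 2 (λ x m → m := (x :+ m) :+ :- x) refl x (c * w)) (x≡y⇒x-y≡0 eq))
    from : ∀ x c → x + c * w ≢ x → c ≢ 0#
    from x c ne refl = ne (trans (cong (x +_) (zeroˡ w)) (+-identityʳ x))
    off-diagonal : ℕ
    off-diagonal = sum (λ x → sum (λ y → [ ¬? (y ≟ x) ] ℕ.* (b x ℕ.* b y)))
    idem : ∀ x → b x ℕ.* b x ≡ b x
    idem x with inBase? x
    ... | yes _ = refl
    ... | no _ = refl
    split : ∀ (x y : Fin q) n → [ ¬? (y ≟ x) ] ℕ.* n ℕ.+ [ y ≟ x ] ℕ.* n ≡ n
    split x y n with y ≟ x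
    ... | yes _ = ℕₚ.+-identityʳ n
    ... | no _ = trans (ℕₚ.+-identityʳ (n ℕ.+ 0)) (ℕₚ.+-identityʳ n)
    total : off-diagonal ℕ.+ k ≡ k ℕ.* k
    total = begin
      off-diagonal ℕ.+ k
        ≡⟨ cong (off-diagonal ℕ.+_) (sum-cong-≗ (λ x → sym (trans (sum-[≟] x (λ y → b x ℕ.* b y)) (idem x)))) ⟩
      off-diagonal ℕ.+ sum (λ x → sum (λ y → [ y ≟ x ] ℕ.* (b x ℕ.* b y)))
        ≡⟨ sym (∑-distrib-+ (λ x → sum (λ y → [ ¬? (y ≟ x) ] ℕ.* (b x ℕ.* b y))) (λ x → sum (λ y → [ y ≟ x ] ℕ.* (b x ℕ.* b y)))) ⟩
      sum (λ x → sum (λ y → [ ¬? (y ≟ x) ] ℕ.* (b x ℕ.* b y)) ℕ.+ sum (λ y → [ y ≟ x ] ℕ.* (b x ℕ.* b y)))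
        ≡⟨ sum-cong-≗ (λ x → trans
             (sym (∑-distrib-+ (λ y → [ ¬? (y ≟ x) ] ℕ.* (b x ℕ.* b y)) (λ y → [ y ≟ x ] ℕ.* (b x ℕ.* b y))))
             (trans (sum-cong-≗ (λ y → split x y (b x ℕ.* b y))) (sym (*-distribˡ-sum (b x) b)))) ⟩
      sum (λ x → b x ℕ.* k)
        ≡⟨ sym (*-distribʳ-sum k b) ⟩
      k ℕ.* k ∎

  -- `Rep` restricts the parameters so that every block is listed exactly once: all c ≠ 0 when the
  -- stabiliser is trivial, one from each pair ±c when it contains the reflection.
  module Representatives (Rep : Fin q → Set) (rep? : Decidable Rep)
      (rep-nonzero : ∀ {c} → Rep c → c ≢ 0#)
      (rep-unique : ∀ {c d c′ d′} → Rep c → Rep c′ → block c d ≡ block c′ d′ → c ≡ c′ × d ≡ d′)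
      (rep-exists : ∀ c d → c ≢ 0# → ∃ λ c′ → ∃ λ d′ → Rep c′ × block c d ≡ block c′ d′)
      (λ′ : ℕ)
      (rep-count : ∀ {u v} → u ≢ v →
        sum (λ c → sum (λ d → [ rep? c ] ℕ.* (b (c * u + d) ℕ.* b (c * v + d)))) ≡ λ′) where

    private
      good? : Decidable (λ (cd : Fin q × Fin q) → Rep (proj₁ cd))
      good? (c , _) = rep? c
      params : List (Fin q × Fin q)
      params = filter good? (cartesianProduct (allFin q) (allFin q))
      blocks : List (Subset q)
      blocks = List.map (uncurry block) params

      λ-count : ∀ T → ∣ T ∣ ≡ 2 → length (filter (T ⊆?_) blocks) ≡ λ′
      λ-count T ∣T∣≡2 with ∣p∣≡2⇒pair T ∣T∣≡2
      ... | u , v , u≢v , u∈ , v∈ , only = begin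
        length (filter (T ⊆?_) blocks)
          ≡⟨ length-filter-map-filter (T ⊆?_) good? (uncurry block) (cartesianProduct (allFin q) (allFin q)) ⟩
        sumᴸ (List.map (λ cd → [ good? cd ] ℕ.* [ T ⊆? uncurry block cd ]) (cartesianProduct (allFin q) (allFin q)))
          ≡⟨ sum-cartesianProduct (λ cd → [ good? cd ] ℕ.* [ T ⊆? uncurry block cd ]) (allFin q) (allFin q) ⟩
        sumᴸ (List.map (λ c → sumᴸ (List.map (λ d → [ rep? c ] ℕ.* [ T ⊆? block c d ]) (allFin q))) (allFin q))
          ≡⟨ sum-allFin (λ c → sumᴸ (List.map (λ d → [ rep? c ] ℕ.* [ T ⊆? block c d ]) (allFin q))) ⟩
        sum (λ c → sumᴸ (List.map (λ d → [ rep? c ] ℕ.* [ T ⊆? block c d ]) (allFin q)))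
          ≡⟨ sum-cong-≗ (λ c → trans (sum-allFin (λ d → [ rep? c ] ℕ.* [ T ⊆? block c d ]))
               (sum-cong-≗ (λ d → cong ([ rep? c ] ℕ.*_) (contains c d)))) ⟩
        sum (λ c → sum (λ d → [ rep? c ] ℕ.* (b (c * u + d) ℕ.* b (c * v + d))))
          ≡⟨ rep-count u≢v ⟩
        λ′ ∎
        where
        contains : ∀ c d → [ T ⊆? block c d ] ≡ b (c * u + d) ℕ.* b (c * v + d)
        contains c d = trans
          ([]-cong (T ⊆? block c d) (inBase? (c * u + d) ×-dec inBase? (c * v + d))
            (λ T⊆ → ∈block⁻ c d (T⊆ u∈) , ∈block⁻ c d (T⊆ v∈))
            (λ { (pu , pv) x∈ → [ (λ { refl → ∈block⁺ c d pu }) , (λ { refl → ∈block⁺ c d pv }) ]′ (only x∈) }))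
          ([×]≡* (inBase? (c * u + d)) (inBase? (c * v + d)))

    isDesign : IsDesign 2 q k λ′ (IsBlock F τ)
    isDesign = blocks ,
      unique-map (uncurry block) (Uniqueₚ.filter⁺ good? (Uniqueₚ.cartesianProduct⁺ (Uniqueₚ.allFin⁺ q) (Uniqueₚ.allFin⁺ q)))
        (λ {cd} {cd′} p p′ eq → let c≡ , d≡ = rep-unique (proj₂ (∈-filter⁻ good? {xs = cartesianProduct (allFin q) (allFin q)} p))
                                        (proj₂ (∈-filter⁻ good? {xs = cartesianProduct (allFin q) (allFin q)} p′)) eq
                                 in cong₂ _,_ c≡ d≡) ,
      (λ S → mk⇔ (listed⇒block S) (block⇒listed S)) ,
      (λ S isB → let c , d , c≢0 , S≡ = isBlock⇒block isB in trans (cong ∣_∣ S≡) (∣block∣ c d c≢0)) ,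
      λ-count
      where
      listed⇒block : ∀ S → S LM.∈ blocks → IsBlock F τ S
      listed⇒block S S∈ with ∈-map⁻ (uncurry block) S∈
      ... | (c , d) , cd∈ , refl =
        block-isBlock c d (rep-nonzero (proj₂ (∈-filter⁻ good? {xs = cartesianProduct (allFin q) (allFin q)} cd∈)))
      block⇒listed : ∀ S → IsBlock F τ S → S LM.∈ blocks
      block⇒listed S isB with isBlock⇒block isB
      ... | c , d , c≢0 , refl with rep-exists c d c≢0
      ...   | c′ , d′ , rep , eq = subst (LM._∈ blocks) (sym eq)
        (∈-map⁺ (uncurry block) (∈-filter⁺ good? (∈-cartesianProduct⁺ (∈-allFin c′) (∈-allFin d′)) rep))

  trivial-stabiliser⇒design :
    (∀ α β → α ≢ 0# → (∀ v → InBase (point v) → InBase (point (α * v + β)))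
       → (∀ v → InBase (point (α * v + β)) → InBase (point v)) → α ≡ 1# × β ≡ 0#) →
    IsDesign 2 q k (k ℕ.* (k ℕ.∸ 1)) (IsBlock F τ)
  trivial-stabiliser⇒design trivial = Representatives.isDesign (_≢ 0#) nonzero? (λ c≢0 → c≢0)
    (λ c≢0 c′≢0 eq → let module T = Transition c≢0 c′≢0 eq in uncurry T.identity (trivial T.α T.β T.α≢0 T.stable T.stable⁻¹))
    (λ c d c≢0 → c , d , c≢0 , refl) (k ℕ.* (k ℕ.∸ 1)) #pairs

  module _ (-1□ : Square (- 1#)) where
    private
      square-neg : ∀ {x} → Square x → Square (- x)
      square-neg {x} s = subst Square (solve 1 (λ x → (:- con (pos 1)) :* x := :- x) refl x) (square-* -1□ s)

    -- As τ - x = -(x - τ) and (τ - x) - τ = -x, with -1 a square the reflection exchanges the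
    -- squares with their translate by τ.
    inBase-reflect : ∀ {x} → InBase x → InBase (τ + - x)
    inBase-reflect {x} (inj₁ (s , ¬t)) = inj₂
      (proj₂ (inShift⇔ (τ + - x)) (subst Square (solve 2 (λ x t → :- x := (t :+ :- x) :+ :- t) refl x τ) (square-neg s)) ,
       (λ s′ → ¬t (proj₂ (inShift⇔ x) (subst Square (solve 2 (λ x t → :- (t :+ :- x) := x :+ :- t) refl x τ) (square-neg s′)))))
    inBase-reflect {x} (inj₂ (t , ¬s)) = inj₁
      (subst Square (solve 2 (λ x t → :- (x :+ :- t) := t :+ :- x) refl x τ) (square-neg (proj₁ (inShift⇔ x) t)) ,
       (λ t′ → ¬s (subst Square (solve 2 (λ x t → :- ((t :+ :- x) :+ :- t) := x) refl x τ) (square-neg (proj₁ (inShift⇔ (τ + - x)) t′)))))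

    inBase-reflect⁻¹ : ∀ {x} → InBase (τ + - x) → InBase x
    inBase-reflect⁻¹ {x} p = subst InBase (solve 2 (λ x t → t :+ :- (t :+ :- x) := x) refl x τ) (inBase-reflect p)

    reflect : ∀ c d x → (- c) * x + (τ + - d) ≡ τ + - (c * x + d)
    reflect c d x = solve 4 (λ c d x t → (:- c) :* x :+ (t :+ :- d) := t :+ :- (c :* x :+ d)) refl c d x τ

    block-reflect : ∀ c d → block c d ≡ block (- c) (τ + - d)
    block-reflect c d = ⊆-antisym
      (λ {x} x∈ → ∈block⁺ (- c) (τ + - d) (subst InBase (sym (reflect c d x)) (inBase-reflect (∈block⁻ c d x∈))))
      (λ {x} x∈ → ∈block⁺ c d (inBase-reflect⁻¹ (subst InBase (reflect c d x) (∈block⁻ (- c) (τ + - d) x∈))))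

    -- (c , d) and (-c , τ - d) give the same block; keep the one with c < -c.
    reflection-stabiliser⇒design : ∀ λ′ → λ′ ℕ.+ λ′ ≡ k ℕ.* (k ℕ.∸ 1) →
      (∀ α β → α ≢ 0# → (∀ v → InBase (point v) → InBase (point (α * v + β)))
         → (∀ v → InBase (point (α * v + β)) → InBase (point v)) → (α ≡ 1# ⊎ α ≡ - 1#) × β ≡ 0#) →
      IsDesign 2 q k λ′ (IsBlock F τ)
    reflection-stabiliser⇒design λ′ 2λ′≡ stab = Representatives.isDesign Rep rep? rep-nonzero rep-unique rep-exists λ′
        (λ u≢v → halve (trans (count u≢v) (sym 2λ′≡)))
      where
      double : ∀ n → 2 ℕ.* n ≡ n ℕ.+ n
      double n = cong (n ℕ.+_) (ℕₚ.+-identityʳ n)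
      halve : ∀ {m n} → m ℕ.+ m ≡ n ℕ.+ n → m ≡ n
      halve {m} {n} eq = ℕₚ.*-cancelˡ-≡ m n 2 (trans (double m) (trans eq (sym (double n))))
      Rep : Fin q → Set
      -- The order of `Fin q` has no algebraic meaning; it merely chooses between c and -c, which
      -- are distinct for c ≠ 0.
      Rep c = c Fin.< - c
      rep? : Decidable Rep
      rep? c = c <? - c
      rep-nonzero : ∀ {c} → Rep c → c ≢ 0#
      rep-nonzero c<-c refl = <-irrefl (solve 0 (con (pos 0) := :- con (pos 0)) refl) c<-c
      rep-unique : ∀ {c d c′ d′} → Rep c → Rep c′ → block c d ≡ block c′ d′ → c ≡ c′ × d ≡ d′
      rep-unique {c} {d} {c′} {d′} r r′ eq = conclude (stab T.α T.β T.α≢0 T.stable T.stable⁻¹)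
        where
        module T = Transition {c} {d} {c′} {d′} (rep-nonzero r) (rep-nonzero r′) eq
        conclude : (T.α ≡ 1# ⊎ T.α ≡ - 1#) × T.β ≡ 0# → c ≡ c′ × d ≡ d′
        conclude (inj₁ α≡1 , β≡0) = T.identity α≡1 β≡0
        -- Here c′ = -c, and c < -c and -c < c cannot both hold.
        conclude (inj₂ α≡-1 , _) = contradiction
          (subst (- c Fin.<_) (neg-involutive c) (subst Rep (T.opposite α≡-1) r′)) (<-asym r)
      rep-exists : ∀ c d → c ≢ 0# → ∃ λ c′ → ∃ λ d′ → Rep c′ × block c d ≡ block c′ d′
      rep-exists c d c≢0 with <-cmp c (- c)
      ... | tri< c<-c _ _ = c , d , c<-c , refl
      ... | tri≈ _ c≡-c _ = contradiction c≡-c (x≢-x c≢0)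
      ... | tri> _ _ -c<c = - c , τ + - d , subst (- c Fin.<_) (sym (neg-involutive c)) -c<c , block-reflect c d

      count : ∀ {u v} → u ≢ v →
        let N = sum (λ c → sum (λ d → [ rep? c ] ℕ.* (b (c * u + d) ℕ.* b (c * v + d)))) in N ℕ.+ N ≡ k ℕ.* (k ℕ.∸ 1)
      count {u} {v} u≢v = begin
        N ℕ.+ N
          -- The second copy of `N` is reindexed by (c, d) ↦ (-c, τ - d), which preserves `w`.
          -- Together the copies count each c ≠ 0 once, and so all ordered pairs.
          ≡⟨ cong (N ℕ.+_) (trans (sym (sum-reindex -_ -_ neg-involutive neg-involutive (λ c → sum (λ d → [ rep? c ] ℕ.* w c d))))
               (sum-cong-≗ (λ c → sym (sum-reindex (λ d → τ + - d) (λ d → τ + - d) twice twice (λ d → [ rep? (- c) ] ℕ.* w (- c) d))))) ⟩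
        N ℕ.+ sum (λ c → sum (λ d → [ rep? (- c) ] ℕ.* w (- c) (τ + - d)))
          ≡⟨ sym (∑-distrib-+ (λ c → sum (λ d → [ rep? c ] ℕ.* w c d)) (λ c → sum (λ d → [ rep? (- c) ] ℕ.* w (- c) (τ + - d)))) ⟩
        sum (λ c → sum (λ d → [ rep? c ] ℕ.* w c d) ℕ.+ sum (λ d → [ rep? (- c) ] ℕ.* w (- c) (τ + - d)))
          ≡⟨ sum-cong-≗ (λ c → trans (sym (∑-distrib-+ (λ d → [ rep? c ] ℕ.* w c d) (λ d → [ rep? (- c) ] ℕ.* w (- c) (τ + - d))))
               (sum-cong-≗ (λ d → trans (cong (λ z → [ rep? c ] ℕ.* w c d ℕ.+ [ rep? (- c) ] ℕ.* z) (w-reflect c d))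
                 (trans (sym (ℕₚ.*-distribʳ-+ (w c d) [ rep? c ] [ rep? (- c) ])) (cong (ℕ._* w c d) (one-of c)))))) ⟩
        sum (λ c → sum (λ d → [ nonzero? c ] ℕ.* w c d))
          ≡⟨ #pairs u≢v ⟩
        k ℕ.* (k ℕ.∸ 1) ∎
        where
        w : Fin q → Fin q → ℕ
        w c d = b (c * u + d) ℕ.* b (c * v + d)
        N : ℕ
        N = sum (λ c → sum (λ d → [ rep? c ] ℕ.* w c d))
        twice : ∀ d → τ + - (τ + - d) ≡ d
        twice d = solve 2 (λ t d → t :+ :- (t :+ :- d) := d) refl τ d
        b-reflect : ∀ c d x → b ((- c) * x + (τ + - d)) ≡ b (c * x + d)
        b-reflect c d x = trans (cong b (reflect c d x))
          ([]-cong (inBase? (τ + - (c * x + d))) (inBase? (c * x + d)) inBase-reflect⁻¹ inBase-reflect)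
        w-reflect : ∀ c d → w (- c) (τ + - d) ≡ w c d
        w-reflect c d = cong₂ ℕ._*_ (b-reflect c d u) (b-reflect c d v)
        one-of : ∀ c → [ rep? c ] ℕ.+ [ rep? (- c) ] ≡ [ nonzero? c ]
        one-of c with <-cmp c (- c)
        ... | tri< c<-c _ ¬-c<c = trans (cong₂ ℕ._+_ ([]-true (rep? c) c<-c)
                ([]-false (rep? (- c)) (λ r → ¬-c<c (subst (- c Fin.<_) (neg-involutive c) r))))
                (sym ([]-true (nonzero? c) (rep-nonzero c<-c)))
        ... | tri> ¬c<-c _ -c<c = trans (cong₂ ℕ._+_ ([]-false (rep? c) ¬c<-c)
                ([]-true (rep? (- c)) (subst (- c Fin.<_) (sym (neg-involutive c)) -c<c)))
                (sym ([]-true (nonzero? c) (λ { refl → <-irrefl (solve 0 (:- con (pos 0) := con (pos 0)) refl) -c<c })))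
        ... | tri≈ ¬c<-c c≡-c ¬-c<c = trans (cong₂ ℕ._+_ ([]-false (rep? c) ¬c<-c)
                ([]-false (rep? (- c)) (λ r → ¬-c<c (subst (- c Fin.<_) (neg-involutive c) r))))
                (sym ([]-false (nonzero? c) (λ c≢0 → x≢-x c≢0 c≡-c)))

  -- `base-sum-formula` over ℕ for the constant 1: the hyperbola has one point for each s ≠ 0, hence
  -- n = q - 1 points, and `hyp + 2` cancels from both sides.
  block-size : ∃ λ n → q ≡ suc n ×
    k ℕ.+ k ≡ n ℕ.+ (([ square? τ ] ℕ.+ [ square? τ ]) ℕ.+ ([ square? (- τ) ] ℕ.+ [ square? (- τ) ]))
  block-size = hyp , q≡suc , ℕₚ.+-cancelʳ-≡ (hyp ℕ.+ 2) _ _ (begin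
      k ℕ.+ k ℕ.+ (hyp ℕ.+ 2)
        ≡⟨ sym (ℕₚ.+-assoc (k ℕ.+ k) hyp 2) ⟩
      k ℕ.+ k ℕ.+ hyp ℕ.+ 2
        ≡⟨ cong (λ x → x ℕ.+ x ℕ.+ hyp ℕ.+ 2) (sym base≡k) ⟩
      W.base-sum (λ _ → 1) ℕ.+ W.base-sum (λ _ → 1) ℕ.+ hyp ℕ.+ 2
        ≡⟨ W.base-sum-formula (λ _ → 1) ⟩
      sum {q} (λ _ → 1) ℕ.+ sum {q} (λ _ → 1) ℕ.+ (t ℕ.* 1 ℕ.+ t′ ℕ.* 1)
        ≡⟨ cong₂ (λ x y → x ℕ.+ x ℕ.+ y) (trans (sum-one q) q≡suc) (cong₂ ℕ._+_ (ℕₚ.*-identityʳ t) (ℕₚ.*-identityʳ t′)) ⟩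
      suc hyp ℕ.+ suc hyp ℕ.+ (t ℕ.+ t′)
        ≡⟨ ℕsolve 2 (λ h s → (Ncon 1 :+ℕ h) :+ℕ (Ncon 1 :+ℕ h) :+ℕ s :=ℕ h :+ℕ s :+ℕ (h :+ℕ Ncon 2)) refl hyp (t ℕ.+ t′) ⟩
      hyp ℕ.+ (t ℕ.+ t′) ℕ.+ (hyp ℕ.+ 2) ∎)
    where
    open import Data.Nat.Solver using (module +-*-Solver)
    open +-*-Solver using () renaming (solve to ℕsolve; con to Ncon; _:+_ to _:+ℕ_; _:=_ to _:=ℕ_)
    module W = Weights ℕₚ.+-*-isCommutativeSemiring
    hyp t t′ : ℕ
    hyp = W.hyperbola-sum (λ _ → 1)
    t = [ square? τ ] ℕ.+ [ square? τ ]
    t′ = [ square? (- τ) ] ℕ.+ [ square? (- τ) ]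
    base≡k : W.base-sum (λ _ → 1) ≡ k
    base≡k = trans (sum-cong-≗ (λ v → ℕₚ.*-identityʳ (b (point v)))) (sum-reindex point coord point-coord coord-point b)
    q≡suc : q ≡ suc hyp
    q≡suc = begin
      q                                                     ≡⟨ sym (sum-one q) ⟩
      sum {q} (λ _ → 1)                                     ≡⟨ sum-cong-≗ split ⟩
      sum (λ s → [ s ≟ 0# ] ℕ.* 1 ℕ.+ [ nonzero? s ] ℕ.* 1) ≡⟨ ∑-distrib-+ (λ s → [ s ≟ 0# ] ℕ.* 1) (λ s → [ nonzero? s ] ℕ.* 1) ⟩
      sum (λ s → [ s ≟ 0# ] ℕ.* 1) ℕ.+ hyp                  ≡⟨ cong (ℕ._+ hyp) (sum-[≟] 0# (λ _ → 1)) ⟩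
      suc hyp ∎
      where
      split : ∀ s → 1 ≡ [ s ≟ 0# ] ℕ.* 1 ℕ.+ [ nonzero? s ] ℕ.* 1
      split s with s ≟ 0#
      ... | yes _ = refl
      ... | no _ = refl

-- Residues modulo 4 and the parameters of the design

open import Data.Nat using (_+_; _*_; _∸_; _^_; _<_; _≤_)
open import Data.Nat.DivMod using (_/_; _%_; m≡m%n+[m/n]*n; [m+kn]%n≡m%n; m*n/n≡m)
open import Data.Nat.Primality using (Prime)
open import Data.Nat.Solver using (module +-*-Solver)

open +-*-Solver using (solve; con; _:+_; _:*_; _:=_)

[m+m]%2≡0 : ∀ m → (m + m) % 2 ≡ 0
[m+m]%2≡0 m = trans (cong (_% 2) (solve 1 (λ m → m :+ m := con 0 :+ m :* con 2) refl m)) ([m+kn]%n≡m%n 0 m 2)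

%4-odd : ∀ {q} → q % 4 ≡ 3 ⊎ q % 4 ≡ 1 → ∀ m → q ≢ m + m
%4-odd {q} q%4 m q≡m+m = 1≢0 (trans (sym (q%2≡1 q%4)) (trans (cong (_% 2) q≡m+m) ([m+m]%2≡0 m)))
  where
  1≢0 : 1 ≢ 0
  1≢0 ()
  q%2≡1 : q % 4 ≡ 3 ⊎ q % 4 ≡ 1 → q % 2 ≡ 1
  q%2≡1 (inj₁ eq) = trans (cong (_% 2) (trans (m≡m%n+[m/n]*n q 4) (trans (cong (_+ q / 4 * 4) eq)
    (solve 1 (λ k → con 3 :+ k :* con 4 := con 1 :+ (con 1 :+ k :* con 2) :* con 2) refl (q / 4))))) ([m+kn]%n≡m%n 1 (1 + q / 4 * 2) 2)
  q%2≡1 (inj₂ eq) = trans (cong (_% 2) (trans (m≡m%n+[m/n]*n q 4) (trans (cong (_+ q / 4 * 4) eq)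
    (solve 1 (λ k → con 1 :+ k :* con 4 := con 1 :+ (k :* con 2) :* con 2) refl (q / 4))))) ([m+kn]%n≡m%n 1 (q / 4 * 2) 2)

-- None of 10, 11, 12 is 1 modulo 4. This provides the moments up to order 11 that the case of equal
-- signs works with.
q%4≡1⇒12<q : ∀ {q} → 9 < q → q % 4 ≡ 1 → 12 < q
q%4≡1⇒12<q {q} 9<q eq with ℕₚ.m≤n⇒∃[o]m+o≡n 9<q
q%4≡1⇒12<q 9<q () | 0 , refl
q%4≡1⇒12<q 9<q () | 1 , refl
q%4≡1⇒12<q 9<q () | 2 , refl
... | suc (suc (suc o)) , refl = ℕₚ.m≤m+n 13 o

m+m≡n⇒n/2≡m : ∀ {m n} → m + m ≡ n → n / 2 ≡ m
m+m≡n⇒n/2≡m {m} refl = trans (cong (_/ 2) (solve 1 (λ m → m :+ m := m :* con 2) refl m)) (m*n/n≡m m 2)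

n[n∸1]-even : ∀ n → ∃ λ m → m + m ≡ n * (n ∸ 1)
n[n∸1]-even zero = 0 , refl
n[n∸1]-even (suc zero) = 0 , refl
n[n∸1]-even (suc (suc n)) with n[n∸1]-even (suc n)
... | m , eq = m + suc n , trans (solve 2 (λ m n → (m :+ (con 1 :+ n)) :+ (m :+ (con 1 :+ n)) := (m :+ m) :+ (con 2 :+ n :* con 2)) refl m n)
  (trans (cong (_+ (2 + n * 2)) eq)
    (solve 1 (λ n → (con 1 :+ n) :* n :+ (con 2 :+ n :* con 2) := (con 2 :+ n) :* (con 1 :+ n)) refl n))

module _ {q : ℕ} (9<q : 9 < q) (F : FieldOn q) (τ : Fin q) (τ≢0 : τ ≢ FieldOn.0F F) where

  module _ (q%4≡3 : q % 4 ≡ 3) where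
    open Design F (%4-odd (inj₁ q%4≡3)) τ τ≢0
    open Base F (%4-odd (inj₁ q%4≡3)) τ τ≢0 using
      (Square; NonSquare; square?; 1#; -_; -1-square⇒4∣q-1; square-cancel; nonsquare-*; neg-nonzero; neg1*)

    -1-nonsquare : NonSquare (- 1#)
    -1-nonsquare s = let m , q≡ = -1-square⇒4∣q-1 s in contradiction (trans (sym q%4≡3) (trans (cong (_% 4) (trans q≡
      (solve 1 (λ m → (m :+ m) :+ (m :+ m) :+ con 1 := con 1 :+ m :* con 4) refl m))) ([m+kn]%n≡m%n 1 m 4))) λ ()

    -- Multiplication by the nonsquare -1 exchanges squares and nonsquares.
    signs : (NonSquare (- τ) × Square τ) ⊎ (Square (- τ) × NonSquare τ)
    signs with square? τ
    ... | yes s = inj₁ ((λ s′ → -1-nonsquare (square-cancel s (subst Square (neg1* τ) s′))) , s)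
    ... | no ¬s = inj₂ (subst Square (sym (neg1* τ)) (nonsquare-* τ≢0 ¬s (neg-nonzero (FieldOn.0≢1 F ∘ sym)) -1-nonsquare) , ¬s)

    2k≡q+1 : k + k ≡ q + 1
    2k≡q+1 = let n , q≡ , 2k≡ = block-size in trans 2k≡ (trans (cong (n +_) (two signs))
        (trans (solve 1 (λ n → n :+ con 2 := con 1 :+ n :+ con 1) refl n) (cong (_+ 1) (sym q≡))))
      where
      open Count
      two : (NonSquare (- τ) × Square τ) ⊎ (Square (- τ) × NonSquare τ) →
            ([ square? τ ] + [ square? τ ]) + ([ square? (- τ) ] + [ square? (- τ) ]) ≡ 2
      two (inj₁ (¬s′ , s)) rewrite []-true (square? τ) s | []-false (square? (- τ)) ¬s′ = refl
      two (inj₂ (s′ , ¬s)) rewrite []-false (square? τ) ¬s | []-true (square? (- τ)) s′ = refl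

    design-3mod4 : IsDesign 2 q ((q + 1) / 2) (((q + 1) / 2) * (((q + 1) / 2) ∸ 1)) (IsBlock F τ)
    design-3mod4 = subst (λ k → IsDesign 2 q k (k * (k ∸ 1)) (IsBlock F τ)) (sym (m+m≡n⇒n/2≡m 2k≡q+1))
      (trivial-stabiliser⇒design (λ α β α≢0 st st⁻¹ →
        Stabiliser.trivial-if-signs-differ F (%4-odd (inj₁ q%4≡3)) τ τ≢0 α β α≢0 st st⁻¹ 9<q signs))

  module _ (q%4≡1 : q % 4 ≡ 1) where
    open Design F (%4-odd (inj₂ q%4≡1)) τ τ≢0
    open Base F (%4-odd (inj₂ q%4≡1)) τ τ≢0 using
      (Square; NonSquare; square?; 1#; -_; -1-nonsquare⇒4∣q-3; square-*; square-cancel; neg1*; *-comm)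

    -1-square : Square (- 1#)
    -1-square with square? (- 1#)
    ... | yes s = s
    ... | no ¬s = let m , q≡ = -1-nonsquare⇒4∣q-3 ¬s in contradiction (trans (sym q%4≡1) (trans (cong (_% 4) (trans q≡
      (solve 1 (λ m → (m :+ m :+ con 1) :+ (m :+ m :+ con 1) :+ con 1 := con 3 :+ m :* con 4) refl m))) ([m+kn]%n≡m%n 3 m 4))) λ ()

    half : ∃ λ m → m + m ≡ k * (k ∸ 1)
    half = n[n∸1]-even k

    -- Both halvings in the parameters are exact. The design is built for `k` and some m with m + m
    -- = k(k - 1), and only then transported to the quotients.
    with-size : ∀ {n} → k + k ≡ n → (∃ λ m → m + m ≡ k * (k ∸ 1) × IsDesign 2 q k m (IsBlock F τ)) →
                IsDesign 2 q (n / 2) (((n / 2) * ((n / 2) ∸ 1)) / 2) (IsBlock F τ)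
    with-size 2k≡n (m , 2m≡ , design) = subst (λ k → IsDesign 2 q k ((k * (k ∸ 1)) / 2) (IsBlock F τ))
      (sym (m+m≡n⇒n/2≡m 2k≡n)) (subst (λ l → IsDesign 2 q k l (IsBlock F τ)) (sym (m+m≡n⇒n/2≡m 2m≡)) design)

    design-square : IsSquare F τ → IsDesign 2 q ((q + 3) / 2) ((((q + 3) / 2) * (((q + 3) / 2) ∸ 1)) / 2) (IsBlock F τ)
    design-square s = let m , 2m≡ = half in with-size 2k≡q+3 (m , 2m≡ ,
        reflection-stabiliser⇒design -1-square m 2m≡ (λ α β α≢0 st st⁻¹ →
          Stabiliser.SquareSigns.half-turn F (%4-odd (inj₂ q%4≡1)) τ τ≢0 α β α≢0 st st⁻¹ (q%4≡1⇒12<q 9<q q%4≡1) s s′))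
      where
      open Count
      s′ : Square (- τ)
      s′ = subst Square (trans (*-comm _ _) (sym (neg1* τ))) (square-* -1-square s)
      2k≡q+3 : k + k ≡ q + 3
      2k≡q+3 = let n , q≡ , 2k≡ = block-size in trans 2k≡ (trans (cong (n +_) four)
          (trans (solve 1 (λ n → n :+ con 4 := con 1 :+ n :+ con 3) refl n) (cong (_+ 3) (sym q≡))))
        where
        four : ([ square? τ ] + [ square? τ ]) + ([ square? (- τ) ] + [ square? (- τ) ]) ≡ 4
        four rewrite []-true (square? τ) s | []-true (square? (- τ)) s′ = refl

    design-nonsquare : IsNonsquare F τ → IsDesign 2 q ((q ∸ 1) / 2) ((((q ∸ 1) / 2) * (((q ∸ 1) / 2) ∸ 1)) / 2) (IsBlock F τ)
    design-nonsquare (_ , no-root) = let m , 2m≡ = half in with-size 2k≡q-1 (m , 2m≡ ,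
        reflection-stabiliser⇒design -1-square m 2m≡ (λ α β α≢0 st st⁻¹ →
          Stabiliser.NonSquareSigns.half-turn F (%4-odd (inj₂ q%4≡1)) τ τ≢0 α β α≢0 st st⁻¹ (q%4≡1⇒12<q 9<q q%4≡1) ¬s ¬s′))
      where
      open Count
      ¬s : NonSquare τ
      ¬s (_ , root) = no-root root
      ¬s′ : NonSquare (- τ)
      ¬s′ s′ = ¬s (square-cancel -1-square (subst Square (trans (neg1* τ) (*-comm _ _)) s′))
      2k≡q-1 : k + k ≡ q ∸ 1
      2k≡q-1 = let n , q≡ , 2k≡ = block-size in trans 2k≡ (trans (cong (n +_) none) (trans (ℕₚ.+-identityʳ n) (cong (_∸ 1) (sym q≡))))
        where
        none : ([ square? τ ] + [ square? τ ]) + ([ square? (- τ) ] + [ square? (- τ) ]) ≡ 0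
        none rewrite []-false (square? τ) ¬s | []-false (square? (- τ)) ¬s′ = refl

theorem12 : (p e q : ℕ) → Prime p → p ≢ 2 → 1 ≤ e → q ≡ p ^ e → 9 < q →
    (F : FieldOn q) → (τ : Fin q) → τ ≢ FieldOn.0F F →
    (q % 4 ≡ 3 →
    IsDesign 2 q ((q + 1) / 2) (((q + 1) / 2) * (((q + 1) / 2) ∸ 1)) (IsBlock F τ))
    × (q % 4 ≡ 1 → IsSquare F τ →
    IsDesign 2 q ((q + 3) / 2) ((((q + 3) / 2) * (((q + 3) / 2) ∸ 1)) / 2) (IsBlock F τ))
    × (q % 4 ≡ 1 → IsNonsquare F τ →
    IsDesign 2 q ((q ∸ 1) / 2) ((((q ∸ 1) / 2) * (((q ∸ 1) / 2) ∸ 1)) / 2) (IsBlock F τ))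
theorem12 p e q _ _ _ _ 9<q F τ τ≢0 = design-3mod4 9<q F τ τ≢0 , design-square 9<q F τ τ≢0 , design-nonsquare 9<q F τ τ≢0
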